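{- Let $L$ and $s$ be positive integers with $L \ge 3$ and $L \ge s+1$. Then for every integer $N \ge \Gamma(s)$, the coefficient of $q^N$ in $H_{L,s,L}(q)$ is greater than or equal to $\left\lfloor \frac{N-10s}{(s+2)(s+3)} \right\rfloor$.
   Context: $(a;q)_n := (1-a)(1-aq)\cdots(1-aq^{n-1})$. For positive integers $L,s,k$, $H_{L,s,k}(q) := \frac{q^s(1-q^k)}{(q^s;q)_{L+1}} - \left(\frac{1}{(q^{s+1};q)_L}-1\right)$. Let $P_{L,s} = (s+1)(s+2)\cdots(s+L)$, $$\gamma(L,s) = \big((s+1)+\cdots+(s+L)\big)\cdot\Big(P_{L,s}^{(P_{L,s}^2-1)L+2} + \big((P_{L,s}^2-1)L-2\big)P_{L,s}\Big),$$ and $\Gamma(s) = \gamma(3s+2,s)$. -}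

module Defs where

open import Data.Nat as ℕ using (ℕ; zero; suc; _∸_)
open import Data.Nat.Divisibility using (_∣?_)
open import Data.Integer as ℤ using (ℤ; +_)
open import Data.Bool using (if_then_else_)
open import Relation.Nullary.Decidable using (⌊_⌋)

-- Formal power series in q with integer coefficients: n ↦ coefficient of q^n.
PS : Set
PS = ℕ → ℤ

one : PS
one zero    = + 1
one (suc _) = + 0

qpow : ℕ → PS
qpow k n = if ⌊ n ℕ.≟ k ⌋ then + 1 else + 0

_⊕_ : PS → PS → PS
(f ⊕ g) n = f n ℤ.+ g n

_⊖_ : PS → PS → PS
(f ⊖ g) n = f n ℤ.- g n

sumTo : ℕ → (ℕ → ℤ) → ℤ
sumTo zero    h = h zero
sumTo (suc m) h = sumTo m h ℤ.+ h (suc m)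

_⊛_ : PS → PS → PS
(f ⊛ g) n = sumTo n (λ i → f i ℤ.* g (n ∸ i))

infixl 7 _⊛_
infixl 6 _⊕_ _⊖_

-- 1/(1 - q^j) = Σ_{m ≥ 0} q^{j m}   (used only for j ≥ 1)
geom : ℕ → PS
geom j n = if ⌊ j ∣? n ⌋ then + 1 else + 0

-- 1/(q^a;q)_m = Π_{i=0}^{m-1} 1/(1 - q^{a+i})
invPoch : ℕ → ℕ → PS
invPoch a zero    = one
invPoch a (suc m) = invPoch a m ⊛ geom (a ℕ.+ m)

H : ℕ → ℕ → ℕ → PS
H L s k = (qpow s ⊛ (one ⊖ qpow k) ⊛ invPoch s (suc L)) ⊖ (invPoch (suc s) L ⊖ one)

P : ℕ → ℕ → ℕ
P zero    s = 1
P (suc L) s = P L s ℕ.* (s ℕ.+ suc L)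

S : ℕ → ℕ → ℕ
S zero    s = 0
S (suc L) s = S L s ℕ.+ (s ℕ.+ suc L)

-- γ(L,s) = S · ( P^{(P²-1)L+2} + ((P²-1)L - 2) P )
-- (P ≥ 2 for L, s ≥ 1, so the natural subtractions are exact there)
γ : ℕ → ℕ → ℕ
γ L s = S L s ℕ.* (p ℕ.^ (e ℕ.+ 2) ℕ.+ (e ∸ 2) ℕ.* p)
  where
  p = P L s
  e = (p ℕ.* p ∸ 1) ℕ.* L

Γ : ℕ → ℕ
Γ s = γ (3 ℕ.* s ℕ.+ 2) s

{-# OPTIONS --safe #-}
module Submission where

-- Write g_j = 1/(1 - q^j), K_c = q^s g_s - g_c and let R be the product of the g_j over j in {s+1, ..., s+L} \ {L}.
-- Then H_{L,s,L} = R K_L + 1. Since K_{s+c} g_c - K_c has nonnegative coefficients, K_L can be lowered to K_c with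
-- s + 3 ≤ c ≤ 2s + 2 at the price of the factors g_{L-s}, g_{L-2s}, ..., g_c of R, leaving g_{s+1} g_{s+2} in R
-- (for L ≤ s + 2 one takes c = L and another pair of consecutive parts a, a + 1, except if s = 1 and L = 3).
-- The coefficients of Q = K_c g_a g_{a+1} grow quadratically, with constants depending only on s, so Q is bounded
-- below by -M everywhere, nonnegative from n₀ on, and at least (M + 1) n for n ≥ w. The coefficient of q^N in Q R' is a
-- sum of Q_{N - |ρ|} over partitions ρ into the remaining parts. A negative term has N - |ρ| < n₀, so for large N
-- some part y of ρ occurs more than w / y times; removing 1 + ⌊w / y⌋ copies of it leads to ρ' with
-- n = N - |ρ'| > w, and at most n partitions ρ lead to the same ρ', whence the negative terms are compensated.

open import Defs
open import Data.Nat using (ℕ; _≤_; _+_; _*_)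
open import Data.Integer using (+_; _-_; _/ℕ_) renaming (_≤_ to _≤ℤ_)
open import Data.Nat as ℕ using (zero; suc; _<_; _∸_; _^_; z≤n; s≤s; NonZero)
import Data.Nat.Properties as ℕ
import Data.Nat.Solver as ℕSolver
open import Data.Nat.DivMod using (_/_; m/n*n≤m; m<n⇒m/n≡0; m≡m%n+[m/n]*n; m%n<n)
open import Data.Nat.Divisibility as ℕ using (_∣_; _∣?_)
open import Data.Integer as ℤ using (ℤ; +≤+)
import Data.Integer.Properties as ℤ
import Data.Integer.Solver as ℤSolver
open import Data.Integer.DivMod using ([n/ℕd]*d≤n)
open import Data.Bool using (Bool; true; false; if_then_else_)
open import Data.Empty using (⊥-elim)
open import Data.Maybe using (Maybe; just; nothing)
open import Data.Product using (∃; _×_; _,_; proj₂)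
open import Data.Sum using (_⊎_; inj₁; inj₂)
open import Relation.Nullary using (¬_; yes; no)
open import Relation.Nullary.Decidable using (⌊_⌋)
open import Relation.Binary.PropositionalEquality
open import Algebra.Bundles using (CommutativeRing)
import Algebra.Solver.Ring
import Algebra.Solver.Ring.AlmostCommutativeRing as ACR
import Relation.Binary.Reasoning.Setoid

-- Formal power series as a commutative ring, with a ring solver.

infix 4 _≋_ _≼_

_≋_ : PS → PS → Set
f ≋ g = ∀ n → f n ≡ g n

_≼_ : PS → PS → Set
f ≼ g = ∀ n → f n ≤ℤ g n

tail : PS → PS
tail f n = f (suc n)

⊝_ : PS → PS
(⊝ f) n = ℤ.- f n

0ₚ : PS
0ₚ _ = + 0

infixr 8 _·_
_·_ : ℤ → PS → PS
(k · f) n = k ℤ.* f n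

+-congˡ : ∀ x {y z} → y ≡ z → x ℤ.+ y ≡ x ℤ.+ z
+-congˡ x refl = refl

sumTo-cong : ∀ n {h k} → (∀ i → i ≤ n → h i ≡ k i) → sumTo n h ≡ sumTo n k
sumTo-cong zero    e = e 0 z≤n
sumTo-cong (suc n) e = cong₂ ℤ._+_ (sumTo-cong n (λ i i≤n → e i (ℕ.m≤n⇒m≤1+n i≤n))) (e (suc n) ℕ.≤-refl)

sumTo-suc : ∀ n h → sumTo (suc n) h ≡ h 0 ℤ.+ sumTo n (λ i → h (suc i))
sumTo-suc zero    h = refl
sumTo-suc (suc n) h = trans (cong (ℤ._+ h (suc (suc n))) (sumTo-suc n h)) (ℤ.+-assoc (h 0) _ _)

⊛-suc : ∀ f g n → (f ⊛ g) (suc n) ≡ f 0 ℤ.* g (suc n) ℤ.+ (tail f ⊛ g) n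
⊛-suc f g n = sumTo-suc n (λ i → f i ℤ.* g (suc n ∸ i))

⊛-suc-last : ∀ f g n → (f ⊛ g) (suc n) ≡ (f ⊛ tail g) n ℤ.+ f (suc n) ℤ.* g 0
⊛-suc-last f g n = cong₂ ℤ._+_
  (sumTo-cong n (λ i i≤n → cong (λ k → f i ℤ.* g k) (ℕ.+-∸-assoc 1 i≤n)))
  (cong (λ k → f (suc n) ℤ.* g k) (ℕ.n∸n≡0 n))

⊛-cong : ∀ {f f′ g g′} → f ≋ f′ → g ≋ g′ → f ⊛ g ≋ f′ ⊛ g′
⊛-cong p q n = sumTo-cong n (λ i _ → cong₂ ℤ._*_ (p i) (q (n ∸ i)))

-- Induction on the degree: peeling the first summand of `f ⊛ g` matches peeling the last summand of
-- `g ⊛ f`.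
⊛-comm : ∀ f g → f ⊛ g ≋ g ⊛ f
⊛-comm f g zero    = ℤ.*-comm (f 0) (g 0)
⊛-comm f g (suc n) = begin
  (f ⊛ g) (suc n)                          ≡⟨ ⊛-suc f g n ⟩
  f 0 ℤ.* g (suc n) ℤ.+ (tail f ⊛ g) n     ≡⟨ cong₂ ℤ._+_ (ℤ.*-comm (f 0) _) (⊛-comm (tail f) g n) ⟩
  g (suc n) ℤ.* f 0 ℤ.+ (g ⊛ tail f) n     ≡⟨ ℤ.+-comm (g (suc n) ℤ.* f 0) _ ⟩
  (g ⊛ tail f) n ℤ.+ g (suc n) ℤ.* f 0     ≡⟨ sym (⊛-suc-last g f n) ⟩
  (g ⊛ f) (suc n)                          ∎
  where open ≡-Reasoning

⊛-distribʳ : ∀ h f g → (f ⊕ g) ⊛ h ≋ f ⊛ h ⊕ g ⊛ h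
⊛-distribʳ h f g zero    = ℤ.*-distribʳ-+ (h 0) (f 0) (g 0)
⊛-distribʳ h f g (suc n) = begin
  ((f ⊕ g) ⊛ h) (suc n)
    ≡⟨ ⊛-suc (f ⊕ g) h n ⟩
  (f 0 ℤ.+ g 0) ℤ.* h (suc n) ℤ.+ ((tail f ⊕ tail g) ⊛ h) n
    ≡⟨ +-congˡ ((f 0 ℤ.+ g 0) ℤ.* h (suc n)) (⊛-distribʳ h (tail f) (tail g) n) ⟩
  (f 0 ℤ.+ g 0) ℤ.* h (suc n) ℤ.+ ((tail f ⊛ h) n ℤ.+ (tail g ⊛ h) n)
    ≡⟨ solve 5 (λ a b c x y → (a :+ b) :* c :+ (x :+ y) := (a :* c :+ x) :+ (b :* c :+ y)) refl
         (f 0) (g 0) (h (suc n)) _ _ ⟩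
  (f 0 ℤ.* h (suc n) ℤ.+ (tail f ⊛ h) n) ℤ.+ (g 0 ℤ.* h (suc n) ℤ.+ (tail g ⊛ h) n)
    ≡⟨ sym (cong₂ ℤ._+_ (⊛-suc f h n) (⊛-suc g h n)) ⟩
  (f ⊛ h ⊕ g ⊛ h) (suc n) ∎
  where open ≡-Reasoning
        open ℤSolver.+-*-Solver

⊛-distribˡ : ∀ h f g → h ⊛ (f ⊕ g) ≋ h ⊛ f ⊕ h ⊛ g
⊛-distribˡ h f g n = trans (⊛-comm h (f ⊕ g) n)
  (trans (⊛-distribʳ h f g n) (cong₂ ℤ._+_ (⊛-comm f h n) (⊛-comm g h n)))

·-⊛ : ∀ k f g → (k · f) ⊛ g ≋ k · (f ⊛ g)
·-⊛ k f g zero    = ℤ.*-assoc k (f 0) (g 0)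
·-⊛ k f g (suc n) = begin
  ((k · f) ⊛ g) (suc n)
    ≡⟨ ⊛-suc (k · f) g n ⟩
  k ℤ.* f 0 ℤ.* g (suc n) ℤ.+ ((k · tail f) ⊛ g) n
    ≡⟨ cong₂ ℤ._+_ (ℤ.*-assoc k (f 0) _) (·-⊛ k (tail f) g n) ⟩
  k ℤ.* (f 0 ℤ.* g (suc n)) ℤ.+ k ℤ.* (tail f ⊛ g) n
    ≡⟨ sym (ℤ.*-distribˡ-+ k _ _) ⟩
  k ℤ.* (f 0 ℤ.* g (suc n) ℤ.+ (tail f ⊛ g) n)
    ≡⟨ cong (k ℤ.*_) (sym (⊛-suc f g n)) ⟩
  (k · (f ⊛ g)) (suc n) ∎
  where open ≡-Reasoning

⊛-assoc : ∀ f g h → (f ⊛ g) ⊛ h ≋ f ⊛ (g ⊛ h)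
⊛-assoc f g h zero    = ℤ.*-assoc (f 0) (g 0) (h 0)
⊛-assoc f g h (suc n) = begin
  ((f ⊛ g) ⊛ h) (suc n)
    ≡⟨ ⊛-suc (f ⊛ g) h n ⟩
  f 0 ℤ.* g 0 ℤ.* h (suc n) ℤ.+ (tail (f ⊛ g) ⊛ h) n
    ≡⟨ cong₂ ℤ._+_ (ℤ.*-assoc (f 0) (g 0) _) (⊛-cong {g = h} (⊛-suc f g) (λ _ → refl) n) ⟩
  f 0 ℤ.* (g 0 ℤ.* h (suc n)) ℤ.+ ((f 0 · tail g ⊕ tail f ⊛ g) ⊛ h) n
    ≡⟨ +-congˡ (f 0 ℤ.* (g 0 ℤ.* h (suc n))) (⊛-distribʳ h (f 0 · tail g) (tail f ⊛ g) n) ⟩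
  f 0 ℤ.* (g 0 ℤ.* h (suc n)) ℤ.+ (((f 0 · tail g) ⊛ h) n ℤ.+ ((tail f ⊛ g) ⊛ h) n)
    ≡⟨ +-congˡ (f 0 ℤ.* (g 0 ℤ.* h (suc n))) (cong₂ ℤ._+_ (·-⊛ (f 0) (tail g) h n) (⊛-assoc (tail f) g h n)) ⟩
  f 0 ℤ.* (g 0 ℤ.* h (suc n)) ℤ.+ (f 0 ℤ.* (tail g ⊛ h) n ℤ.+ (tail f ⊛ (g ⊛ h)) n)
    ≡⟨ solve 4 (λ a x y z → a :* x :+ (a :* y :+ z) := a :* (x :+ y) :+ z) refl
         (f 0) (g 0 ℤ.* h (suc n)) _ _ ⟩
  f 0 ℤ.* (g 0 ℤ.* h (suc n) ℤ.+ (tail g ⊛ h) n) ℤ.+ (tail f ⊛ (g ⊛ h)) n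
    ≡⟨ cong (λ x → f 0 ℤ.* x ℤ.+ (tail f ⊛ (g ⊛ h)) n) (sym (⊛-suc g h n)) ⟩
  f 0 ℤ.* (g ⊛ h) (suc n) ℤ.+ (tail f ⊛ (g ⊛ h)) n
    ≡⟨ sym (⊛-suc f (g ⊛ h) n) ⟩
  (f ⊛ (g ⊛ h)) (suc n) ∎
  where open ≡-Reasoning
        open ℤSolver.+-*-Solver

⊛-zeroˡ : ∀ f → 0ₚ ⊛ f ≋ 0ₚ
⊛-zeroˡ f zero    = refl
⊛-zeroˡ f (suc n) = trans (⊛-suc 0ₚ f n) (trans (ℤ.+-identityˡ _) (⊛-zeroˡ f n))

⊛-identityˡ : ∀ f → one ⊛ f ≋ f
⊛-identityˡ f zero    = ℤ.*-identityˡ (f 0)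
⊛-identityˡ f (suc n) = trans (⊛-suc one f n)
  (trans (cong₂ ℤ._+_ (ℤ.*-identityˡ (f (suc n))) (⊛-zeroˡ f n)) (ℤ.+-identityʳ _))

PS-commutativeRing : CommutativeRing _ _
PS-commutativeRing = record
  { Carrier = PS ; _≈_ = _≋_ ; _+_ = _⊕_ ; _*_ = _⊛_ ; -_ = ⊝_ ; 0# = 0ₚ ; 1# = one
  ; isCommutativeRing = record
    { isRing = record
      { +-isAbelianGroup = record
        { isGroup = record
          { isMonoid = record
            { isSemigroup = record
              { isMagma = record
                { isEquivalence = record
                  { refl  = λ _ → refl
                  ; sym   = λ p n → sym (p n)
                  ; trans = λ p q n → trans (p n) (q n)
                  }
                ; ∙-cong = λ p q n → cong₂ ℤ._+_ (p n) (q n)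
                }
              ; assoc = λ f g h n → ℤ.+-assoc (f n) (g n) (h n)
              }
            ; identity = (λ f n → ℤ.+-identityˡ (f n)) , (λ f n → ℤ.+-identityʳ (f n))
            }
          ; inverse = (λ f n → ℤ.+-inverseˡ (f n)) , (λ f n → ℤ.+-inverseʳ (f n))
          ; ⁻¹-cong = λ p n → cong ℤ.-_ (p n)
          }
        ; comm = λ f g n → ℤ.+-comm (f n) (g n)
        }
      ; *-cong     = ⊛-cong
      ; *-assoc    = ⊛-assoc
      ; *-identity = ⊛-identityˡ , (λ f n → trans (⊛-comm f one n) (⊛-identityˡ f n))
      ; distrib    = ⊛-distribˡ , ⊛-distribʳ
      }
    ; *-comm = ⊛-comm
    }
  }

PS-ACR : ACR.AlmostCommutativeRing _ _
PS-ACR = ACR.fromCommutativeRing PS-commutativeRing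

-- Agrees with k · one; the separate clause makes the literal 1 of the solver definitionally equal to one.
constant : ℤ → PS
constant (+ 1) = one
constant k     = k · one

constant-· : ∀ k → constant k ≋ k · one
constant-· (+ 0)             n = refl
constant-· (+ 1)             n = sym (ℤ.*-identityˡ (one n))
constant-· (+ suc (suc k))   n = refl
constant-· ℤ.-[1+ k ]        n = refl

constant-homo : CommutativeRing.rawRing ℤ.+-*-commutativeRing ACR.-Raw-AlmostCommutative⟶ PS-ACR
constant-homo = record
  { ⟦_⟧    = constant
  ; +-homo = λ k l n → trans (constant-· (k ℤ.+ l) n)
      (trans (ℤ.*-distribʳ-+ (one n) k l) (sym (cong₂ ℤ._+_ (constant-· k n) (constant-· l n))))
  ; *-homo = λ k l n → trans (constant-· (k ℤ.* l) n)
      (trans (ℤ.*-assoc k l (one n))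
        (sym (trans (⊛-cong (constant-· k) (constant-· l) n)
          (trans (·-⊛ k one (l · one) n) (cong (k ℤ.*_) (⊛-identityˡ (l · one) n))))))
  ; -‿homo = λ k n → trans (constant-· (ℤ.- k) n)
      (trans (sym (ℤ.neg-distribˡ-* k (one n))) (cong ℤ.-_ (sym (constant-· k n))))
  ; 0-homo = λ n → refl
  ; 1-homo = λ n → refl
  }

constant-≟ : ∀ k l → Maybe (constant k ≋ constant l)
constant-≟ k l with k ℤ.≟ l
... | yes k≡l = just (λ n → cong (λ m → constant m n) k≡l)
... | no  _   = nothing

module PS-Solver = Algebra.Solver.Ring
  (CommutativeRing.rawRing ℤ.+-*-commutativeRing) PS-ACR constant-homo constant-≟

open CommutativeRing PS-commutativeRing using () renaming (refl to ≋-refl; sym to ≋-sym; trans to ≋-trans)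
module ≋-Reasoning = Relation.Binary.Reasoning.Setoid (CommutativeRing.setoid PS-commutativeRing)

⊕-cong : ∀ {f f′ g g′} → f ≋ f′ → g ≋ g′ → f ⊕ g ≋ f′ ⊕ g′
⊕-cong p q n = cong₂ ℤ._+_ (p n) (q n)

⊖-cong : ∀ {f f′ g g′} → f ≋ f′ → g ≋ g′ → f ⊖ g ≋ f′ ⊖ g′
⊖-cong p q n = cong₂ _-_ (p n) (q n)

⊛-congˡ : ∀ f {g h} → g ≋ h → f ⊛ g ≋ f ⊛ h
⊛-congˡ f = ⊛-cong {f} (λ _ → refl)

⊛-congʳ : ∀ f {g h} → g ≋ h → g ⊛ f ≋ h ⊛ f
⊛-congʳ f e = ⊛-cong {g = f} e (λ _ → refl)

-- Monomials and geometric series.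

qpow-0 : qpow 0 ≋ one
qpow-0 zero    = refl
qpow-0 (suc n) = refl

qpow-diag : ∀ k → qpow k k ≡ + 1
qpow-diag k with k ℕ.≟ k
... | yes _   = refl
... | no  k≢k = ⊥-elim (k≢k refl)

qpow-≢ : ∀ {k n} → n ≢ k → qpow k n ≡ + 0
qpow-≢ {k} {n} n≢k with n ℕ.≟ k
... | yes n≡k = ⊥-elim (n≢k n≡k)
... | no  _   = refl

tail-qpow : ∀ k → tail (qpow (suc k)) ≋ qpow k
tail-qpow k n with n ℕ.≟ k
... | yes refl = qpow-diag (suc n)
... | no  n≢k  = qpow-≢ (λ e → n≢k (ℕ.suc-injective e))

qpow-⊛-suc : ∀ k f n → (qpow (suc k) ⊛ f) (suc n) ≡ (qpow k ⊛ f) n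
qpow-⊛-suc k f n = trans (⊛-suc (qpow (suc k)) f n)
  (trans (ℤ.+-identityˡ _) (⊛-congʳ f (tail-qpow k) n))

qpow-⊛-+ : ∀ k f n → (qpow k ⊛ f) (k + n) ≡ f n
qpow-⊛-+ zero    f n = trans (⊛-congʳ f qpow-0 n) (⊛-identityˡ f n)
qpow-⊛-+ (suc k) f n = trans (qpow-⊛-suc k f (k + n)) (qpow-⊛-+ k f n)

qpow-⊛-< : ∀ k f {n} → n < k → (qpow k ⊛ f) n ≡ + 0
qpow-⊛-< (suc k) f {zero}  _         = refl
qpow-⊛-< (suc k) f {suc n} (s≤s n<k) = trans (qpow-⊛-suc k f n) (qpow-⊛-< k f n<k)

qpow-+ : ∀ k l → qpow k ⊛ qpow l ≋ qpow (k + l)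
qpow-+ zero    l n       = trans (⊛-congʳ (qpow l) qpow-0 n) (⊛-identityˡ (qpow l) n)
qpow-+ (suc k) l zero    = ℤ.*-zeroˡ (qpow l 0)
qpow-+ (suc k) l (suc n) = trans (qpow-⊛-suc k (qpow l) n) (trans (qpow-+ k l n) (sym (tail-qpow (k + l) n)))

geom-∣ : ∀ {j n} → j ∣ n → geom j n ≡ + 1
geom-∣ {j} {n} j∣n with j ∣? n
... | yes _   = refl
... | no  j∤n = ⊥-elim (j∤n j∣n)

geom-∤ : ∀ {j n} → ¬ j ∣ n → geom j n ≡ + 0
geom-∤ {j} {n} j∤n with j ∣? n
... | yes j∣n = ⊥-elim (j∤n j∣n)
... | no  _   = refl

geom-+ : ∀ j n → geom j (j + n) ≡ geom j n
geom-+ j n with j ∣? n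
... | yes j∣n = geom-∣ (ℕ.∣m∣n⇒∣m+n ℕ.∣-refl j∣n)
... | no  j∤n = geom-∤ (λ j∣j+n → j∤n (ℕ.∣m+n∣m⇒∣n j∣j+n ℕ.∣-refl))

geom-< : ∀ {j n} → n < j → geom j n ≡ one n
geom-< {j} {zero}  _   = geom-∣ (j ℕ.∣0)
geom-< {j} {suc n} n<j = geom-∤ (λ j∣n → ℕ.<⇒≱ n<j (ℕ.∣⇒≤ j∣n))

one-+ : ∀ {j} n → 0 < j → one (j + n) ≡ + 0
one-+ {suc j} n _ = refl

geom-unfold : ∀ {j} → 0 < j → geom j ≋ one ⊕ qpow j ⊛ geom j
geom-unfold {j} 0<j n with ℕ.<-≤-connex n j
... | inj₁ n<j = trans (geom-< n<j)
  (sym (trans (+-congˡ (one n) (qpow-⊛-< j (geom j) n<j)) (ℤ.+-identityʳ _)))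
... | inj₂ j≤n = subst (λ m → geom j m ≡ (one ⊕ qpow j ⊛ geom j) m) (ℕ.m+[n∸m]≡n j≤n)
  (trans (geom-+ j _) (sym (trans (cong₂ ℤ._+_ (one-+ _ 0<j) (qpow-⊛-+ j (geom j) _)) (ℤ.+-identityˡ _))))

-- Nonnegative coefficients.

Nonneg : PS → Set
Nonneg f = ∀ n → + 0 ≤ℤ f n

+-nonneg : ∀ {x y} → + 0 ≤ℤ x → + 0 ≤ℤ y → + 0 ≤ℤ x ℤ.+ y
+-nonneg = ℤ.+-mono-≤

*-nonneg : ∀ {x y} → + 0 ≤ℤ x → + 0 ≤ℤ y → + 0 ≤ℤ x ℤ.* y
*-nonneg {+ m} {+ n} _ _ = subst (+ 0 ≤ℤ_) (ℤ.pos-* m n) (+≤+ z≤n)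

pos-nonneg : ∀ n → + 0 ≤ℤ + n
pos-nonneg n = +≤+ z≤n

sumTo-nonneg : ∀ n {h} → (∀ i → i ≤ n → + 0 ≤ℤ h i) → + 0 ≤ℤ sumTo n h
sumTo-nonneg zero    p = p 0 z≤n
sumTo-nonneg (suc n) p = +-nonneg (sumTo-nonneg n (λ i i≤n → p i (ℕ.m≤n⇒m≤1+n i≤n))) (p (suc n) ℕ.≤-refl)

⊕-nonneg : ∀ {f g} → Nonneg f → Nonneg g → Nonneg (f ⊕ g)
⊕-nonneg p q n = +-nonneg (p n) (q n)

⊛-nonneg : ∀ {f g} → Nonneg f → Nonneg g → Nonneg (f ⊛ g)
⊛-nonneg p q n = sumTo-nonneg n (λ i _ → *-nonneg (p i) (q (n ∸ i)))

-- In degree `n > B + S`, an index `i ≤ B` forces `n ∸ i > S`, where `g` vanishes. So the possibly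
-- negative initial coefficients of `f` never contribute.
⊛-nonneg-beyond : ∀ {f g} B S → (∀ n → B < n → + 0 ≤ℤ f n) → Nonneg g → (∀ n → S < n → g n ≡ + 0) →
  ∀ n → B + S < n → + 0 ≤ℤ (f ⊛ g) n
⊛-nonneg-beyond {f} {g} B S p q z n B+S<n = sumTo-nonneg n term
  where
  term : ∀ i → i ≤ n → + 0 ≤ℤ f i ℤ.* g (n ∸ i)
  term i i≤n with ℕ.<-≤-connex B i
  ... | inj₁ B<i = *-nonneg (p i B<i) (q (n ∸ i))
  ... | inj₂ i≤B = ℤ.≤-reflexive (sym (trans
    (cong (f i ℤ.*_) (z (n ∸ i) (ℕ.m+n≤o⇒m≤o∸n (suc S)
      (ℕ.≤-trans (ℕ.+-monoʳ-≤ (suc S) i≤B) (subst (_≤ n) (cong suc (ℕ.+-comm B S)) B+S<n)))))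
    (ℤ.*-zeroʳ (f i))))

one-nonneg : Nonneg one
one-nonneg zero    = +≤+ z≤n
one-nonneg (suc n) = +≤+ z≤n

if-nonneg : ∀ b → + 0 ≤ℤ (if b then + 1 else + 0)
if-nonneg true  = +≤+ z≤n
if-nonneg false = +≤+ z≤n

if-≤1 : ∀ b → (if b then + 1 else + 0) ≤ℤ + 1
if-≤1 true  = +≤+ (s≤s z≤n)
if-≤1 false = +≤+ z≤n

qpow-nonneg : ∀ k → Nonneg (qpow k)
qpow-nonneg k n = if-nonneg ⌊ n ℕ.≟ k ⌋

geom-nonneg : ∀ j → Nonneg (geom j)
geom-nonneg j n = if-nonneg ⌊ j ∣? n ⌋

-- Finite geometric sums and recursions with a fixed step.

-- block y k = (1 - q^{yk}) / (1 - q^y)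
block : ℕ → ℕ → PS
block y zero    = 0ₚ
block y (suc k) = block y k ⊕ qpow (k * y)

block-nonneg : ∀ y k → Nonneg (block y k)
block-nonneg y zero    n = +≤+ z≤n
block-nonneg y (suc k) n = +-nonneg (block-nonneg y k n) (qpow-nonneg (k * y) n)

-- For `0 < k` the degree of `block y k` is `k * y - y`; moving `y` to the other side avoids
-- truncated subtraction.
block-beyond : ∀ y k {n} → k * y < n + y → block y k n ≡ + 0
block-beyond y zero        _  = refl
block-beyond y (suc k) {n} lt = cong₂ ℤ._+_
  (block-beyond y k (ℕ.<-≤-trans ky<n (ℕ.m≤m+n n y)))
  (qpow-≢ {k * y} (ℕ.>⇒≢ ky<n))
  where
  ky<n : k * y < n
  ky<n = ℕ.+-cancelˡ-< y (k * y) n (subst (y + k * y <_) (ℕ.+-comm n y) lt)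

geom-split : ∀ {y} k → 0 < y → geom y ≋ block y k ⊕ qpow (k * y) ⊛ geom y
geom-split {y} zero    0<y = begin
  geom y                        ≈⟨ solve 1 (λ g → g := con (+ 0) :+ con (+ 1) :* g) (λ _ → refl) (geom y) ⟩
  0ₚ ⊕ one ⊛ geom y             ≈⟨ ⊕-cong {0ₚ} ≋-refl (⊛-congʳ (geom y) (≋-sym qpow-0)) ⟩
  0ₚ ⊕ qpow 0 ⊛ geom y          ∎
  where open ≋-Reasoning
        open PS-Solver
geom-split {y} (suc k) 0<y = begin
  geom y
    ≈⟨ geom-split k 0<y ⟩
  block y k ⊕ qpow (k * y) ⊛ geom y
    ≈⟨ ⊕-cong {block y k} ≋-refl (⊛-congˡ (qpow (k * y)) (geom-unfold 0<y)) ⟩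
  block y k ⊕ qpow (k * y) ⊛ (one ⊕ qpow y ⊛ geom y)
    ≈⟨ solve 4 (λ b p q g → b :+ p :* (con (+ 1) :+ q :* g) := b :+ p :+ q :* p :* g) (λ _ → refl)
         (block y k) (qpow (k * y)) (qpow y) (geom y) ⟩
  block y k ⊕ qpow (k * y) ⊕ qpow y ⊛ qpow (k * y) ⊛ geom y
    ≈⟨ ⊕-cong {block y k ⊕ qpow (k * y)} ≋-refl (⊛-congʳ (geom y) (qpow-+ y (k * y))) ⟩
  block y (suc k) ⊕ qpow (suc k * y) ⊛ geom y ∎
  where open ≋-Reasoning
        open PS-Solver

-- Suited to recursions `g ≋ f ⊕ qpow c ⊛ g`, which relate coefficients `c` apart. The fuel makes
-- the recursion on `n ∸ c` structural.
step-induction : ∀ {ℓ} (A : ℕ → Set ℓ) c → 0 < c → (∀ n → n < c → A n) → (∀ n → A n → A (c + n)) → ∀ n → A n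
step-induction A c 0<c base step n = go n (suc n) ℕ.≤-refl
  where
  go : ∀ n fuel → n < fuel → A n
  go n (suc fuel) (s≤s n≤fuel) with ℕ.<-≤-connex n c
  ... | inj₁ n<c = base n n<c
  ... | inj₂ c≤n = subst A (ℕ.m+[n∸m]≡n c≤n)
    (step (n ∸ c) (go (n ∸ c) fuel (ℕ.<-≤-trans (ℕ.∸-monoʳ-< 0<c c≤n) n≤fuel)))

geom-⊛-unfold : ∀ {j} f → 0 < j → geom j ⊛ f ≋ f ⊕ qpow j ⊛ (geom j ⊛ f)
geom-⊛-unfold {j} f 0<j = begin
  geom j ⊛ f                        ≈⟨ ⊛-congʳ f (geom-unfold 0<j) ⟩
  (one ⊕ qpow j ⊛ geom j) ⊛ f       ≈⟨ solve 3 (λ q g f → (con (+ 1) :+ q :* g) :* f := f :+ q :* (g :* f)) (λ _ → refl) (qpow j) (geom j) f ⟩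
  f ⊕ qpow j ⊛ (geom j ⊛ f)         ∎
  where open ≋-Reasoning
        open PS-Solver

unfold-< : ∀ {f g j n} → g ≋ f ⊕ qpow j ⊛ g → n < j → g n ≡ f n
unfold-< {f} {g} {j} {n} e n<j = trans (e n) (trans (+-congˡ (f n) (qpow-⊛-< j g n<j)) (ℤ.+-identityʳ (f n)))

unfold-+ : ∀ {f g j} n → g ≋ f ⊕ qpow j ⊛ g → g (j + n) ≡ f (j + n) ℤ.+ g n
unfold-+ {f} {g} {j} n e = trans (e (j + n)) (+-congˡ (f (j + n)) (qpow-⊛-+ j g n))

-- Linear bounds for `pair a` and quadratic bounds for `geom s ⊛ pair a`.

-- For 0 < a, the number of j < a with j * suc a ≤ n and a ∣ n - j * suc a is 1 - deficit a a n.
deficit : ℕ → ℕ → PS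
deficit a zero    = 0ₚ
deficit a (suc k) = deficit a k ⊕ qpow k ⊛ block a k

deficit-nonneg : ∀ a k → Nonneg (deficit a k)
deficit-nonneg a zero    n = +≤+ z≤n
deficit-nonneg a (suc k) = ⊕-nonneg (deficit-nonneg a k) (⊛-nonneg (qpow-nonneg k) (block-nonneg a k))

deficit-beyond : ∀ {a} k {n} → k * suc a ≤ n → deficit a k n ≡ + 0
deficit-beyond zero _ = refl
deficit-beyond {a} (suc k) {n} le = cong₂ ℤ._+_ (deficit-beyond k (ℕ.≤-trans (ℕ.m≤n+m _ (suc a)) le))
  (subst (λ m → (qpow k ⊛ block a k) m ≡ + 0) (ℕ.m+[n∸m]≡n k≤n)
    (trans (qpow-⊛-+ k (block a k) (n ∸ k)) (block-beyond a k
      (ℕ.≤-trans (s≤s (ℕ.m≤n+m (k * a) a)) (ℕ.≤-trans (ℕ.m+n≤o⇒m≤o∸n _ le′) (ℕ.m≤m+n _ a))))))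
  where
  le′ : suc (a + k * a) + k ≤ n
  le′ = subst (_≤ n) (cong suc (trans (cong (λ z → a + z) (trans (ℕ.*-suc k a) (ℕ.+-comm k (k * a)))) (sym (ℕ.+-assoc a (k * a) k)))) le
  k≤n : k ≤ n
  k≤n = ℕ.≤-trans (ℕ.m≤n+m k _) le′

-- Since `q^{k(a+1)} = q^k q^{ka}` and `q^{ka} g_a = g_a - block a k`, each monomial of
-- `block (suc a) k` may be replaced by one of `block 1 k` at the cost of one summand of `deficit`.
deficit-split : ∀ {a} k → 0 < a → block (suc a) k ⊛ geom a ⊕ deficit a k ≋ block 1 k ⊛ geom a
deficit-split {a} zero 0<a = solve 1 (λ g → con (+ 0) :* g :+ con (+ 0) := con (+ 0) :* g) (λ _ → refl) (geom a)
  where open PS-Solver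
deficit-split {a} (suc k) 0<a = begin
  (block (suc a) k ⊕ qpow (k * suc a)) ⊛ geom a ⊕ (deficit a k ⊕ qpow k ⊛ block a k)
    ≈⟨ ⊕-cong {g = deficit a (suc k)} (⊛-congʳ (geom a) (⊕-cong {block (suc a) k} ≋-refl qpow-split)) ≋-refl ⟩
  (block (suc a) k ⊕ qpow k ⊛ qpow (k * a)) ⊛ geom a ⊕ (deficit a k ⊕ qpow k ⊛ block a k)
    ≈⟨ solve 6 (λ b p r g d e → (b :+ p :* r) :* g :+ (d :+ p :* e) := (b :* g :+ d) :+ p :* (e :+ r :* g)) (λ _ → refl)
         (block (suc a) k) (qpow k) (qpow (k * a)) (geom a) (deficit a k) (block a k) ⟩
  (block (suc a) k ⊛ geom a ⊕ deficit a k) ⊕ qpow k ⊛ (block a k ⊕ qpow (k * a) ⊛ geom a)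
    ≈⟨ ⊕-cong (deficit-split k 0<a) (⊛-cong qpow-one (≋-sym (geom-split k 0<a))) ⟩
  block 1 k ⊛ geom a ⊕ qpow (k * 1) ⊛ geom a
    ≈⟨ solve 3 (λ b p g → b :* g :+ p :* g := (b :+ p) :* g) (λ _ → refl) (block 1 k) (qpow (k * 1)) (geom a) ⟩
  block 1 (suc k) ⊛ geom a ∎
  where
  open ≋-Reasoning
  open PS-Solver
  qpow-split : qpow (k * suc a) ≋ qpow k ⊛ qpow (k * a)
  qpow-split n = trans (cong (λ m → qpow m n) (ℕ.*-suc k a)) (sym (qpow-+ k (k * a) n))
  qpow-one : qpow k ≋ qpow (k * 1)
  qpow-one n = cong (λ m → qpow m n) (sym (ℕ.*-identityʳ k))

-- This is `(1 - q^a)/(1 - q)` times `1/(1 - q^a)`. Without division, the cancellation adds and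
-- subtracts `geom 1 ⊛ geom a`.
block-1-geom : ∀ {a} → 0 < a → block 1 a ⊛ geom a ≋ geom 1
block-1-geom {a} 0<a = begin
  block 1 a ⊛ geom a
    ≈⟨ solve 4 (λ b q g h → b :* g := (b :+ q :* h) :* g :- h :* (con (+ 1) :+ q :* g) :+ h) (λ _ → refl)
         (block 1 a) (qpow a) (geom a) (geom 1) ⟩
  (block 1 a ⊕ qpow a ⊛ geom 1) ⊛ geom a ⊖ geom 1 ⊛ (one ⊕ qpow a ⊛ geom a) ⊕ geom 1
    ≈⟨ ⊕-cong {g = geom 1} (⊖-cong (⊛-congʳ (geom a) split) (⊛-congˡ (geom 1) (≋-sym (geom-unfold 0<a)))) ≋-refl ⟩
  geom 1 ⊛ geom a ⊖ geom 1 ⊛ geom a ⊕ geom 1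
    ≈⟨ solve 2 (λ h g → h :* g :- h :* g :+ h := h) (λ _ → refl) (geom 1) (geom a) ⟩
  geom 1 ∎
  where
  open ≋-Reasoning
  open PS-Solver
  split : block 1 a ⊕ qpow a ⊛ geom 1 ≋ geom 1
  split = ≋-sym (subst (λ m → geom 1 ≋ block 1 a ⊕ qpow m ⊛ geom 1) (ℕ.*-identityʳ a) (geom-split a (s≤s z≤n)))

pair : ℕ → PS
pair a = geom a ⊛ geom (suc a)

pair-nonneg : ∀ a → Nonneg (pair a)
pair-nonneg a = ⊛-nonneg (geom-nonneg a) (geom-nonneg (suc a))

-- The first `a` multiples of `a + 1` run through all residues modulo `a`, so together with `geom a`
-- they yield `geom 1` up to an initial defect. Hence the coefficients of `pair a` rise by exactly 1
-- over each period `a * suc a`.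
pair-unfold : ∀ {a} → 0 < a → pair a ≋ (geom 1 ⊖ deficit a a) ⊕ qpow (a * suc a) ⊛ pair a
pair-unfold {a} 0<a = begin
  geom a ⊛ geom (suc a)
    ≈⟨ ⊛-congˡ (geom a) (geom-split a (s≤s z≤n)) ⟩
  geom a ⊛ (block (suc a) a ⊕ qpow (a * suc a) ⊛ geom (suc a))
    ≈⟨ solve 5 (λ g b q h d → g :* (b :+ q :* h) := ((b :* g :+ d) :- d) :+ q :* (g :* h)) (λ _ → refl)
         (geom a) (block (suc a) a) (qpow (a * suc a)) (geom (suc a)) (deficit a a) ⟩
  ((block (suc a) a ⊛ geom a ⊕ deficit a a) ⊖ deficit a a) ⊕ qpow (a * suc a) ⊛ pair a
    ≈⟨ ⊕-cong {g = qpow (a * suc a) ⊛ pair a} (⊖-cong {g = deficit a a} (≋-trans (deficit-split a 0<a) (block-1-geom 0<a)) ≋-refl) ≋-refl ⟩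
  (geom 1 ⊖ deficit a a) ⊕ qpow (a * suc a) ⊛ pair a ∎
  where
  open ≋-Reasoning
  open PS-Solver

geom-1 : ∀ n → geom 1 n ≡ + 1
geom-1 n = geom-∣ (ℕ.1∣ n)

pair-< : ∀ {a n} → 0 < a → n < a * suc a → pair a n ≡ + 1 - deficit a a n
pair-< {a} {n} 0<a lt = trans (unfold-< {geom 1 ⊖ deficit a a} {pair a} (pair-unfold 0<a) lt) (cong (_- deficit a a n) (geom-1 n))

pair-+ : ∀ {a} n → 0 < a → pair a (a * suc a + n) ≡ (+ 1 - deficit a a (a * suc a + n)) ℤ.+ pair a n
pair-+ {a} n 0<a = trans (unfold-+ {geom 1 ⊖ deficit a a} {pair a} {a * suc a} n (pair-unfold 0<a)) (cong (λ z → z - deficit a a (a * suc a + n) ℤ.+ pair a n) (geom-1 (a * suc a + n)))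

module _ where
  open ℤSolver.+-*-Solver

  -- Each period adds `1 - deficit`, and the deficit is nonnegative.
  pair-upper : ∀ {a} → 0 < a → ∀ n → + 0 ≤ℤ + n ℤ.+ + (a * suc a) - + (a * suc a) ℤ.* pair a n
  pair-upper {a} 0<a = step-induction _ c (ℕ.*-mono-≤ 0<a (s≤s z≤n)) base step
    where
    c = a * suc a
    V = deficit a a
    base : ∀ n → n < c → + 0 ≤ℤ + n ℤ.+ + c - + c ℤ.* pair a n
    base n n<c = subst (+ 0 ≤ℤ_)
      (trans (solve 3 (λ n c v → n :+ c :* v := n :+ c :- c :* (con (+ 1) :- v)) refl (+ n) (+ c) (V n))
        (cong (λ z → + n ℤ.+ + c - + c ℤ.* z) (sym (pair-< 0<a n<c))))
      (+-nonneg (pos-nonneg n) (*-nonneg (pos-nonneg c) (deficit-nonneg a a n)))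
    step : ∀ n → + 0 ≤ℤ + n ℤ.+ + c - + c ℤ.* pair a n → + 0 ≤ℤ + (c + n) ℤ.+ + c - + c ℤ.* pair a (c + n)
    step n ih = subst (+ 0 ≤ℤ_)
      (trans (solve 4 (λ n c v u → (n :+ c :- c :* u) :+ c :* v := (c :+ n) :+ c :- c :* ((con (+ 1) :- v) :+ u)) refl
               (+ n) (+ c) (V (c + n)) (pair a n))
        (cong (λ z → + (c + n) ℤ.+ + c - + c ℤ.* z) (sym (pair-+ n 0<a))))
      (+-nonneg ih (*-nonneg (pos-nonneg c) (deficit-nonneg a a (c + n))))

  -- In the step the index is at least `a * suc a`, where `deficit-beyond` makes the increment
  -- exactly 1. Below one period the claim is trivial because `n - c` is negative.
  pair-lower : ∀ {a} → 0 < a → ∀ n → + 0 ≤ℤ + (a * suc a) ℤ.* pair a n - + n ℤ.+ + (a * suc a)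
  pair-lower {a} 0<a = step-induction _ c (ℕ.*-mono-≤ 0<a (s≤s z≤n)) base step
    where
    c = a * suc a
    base : ∀ n → n < c → + 0 ≤ℤ + c ℤ.* pair a n - + n ℤ.+ + c
    base n n<c = subst (+ 0 ≤ℤ_)
      (solve 3 (λ n c u → c :* u :+ (c :- n) := c :* u :- n :+ c) refl (+ n) (+ c) (pair a n))
      (+-nonneg (*-nonneg (pos-nonneg c) (pair-nonneg a n)) (ℤ.i≤j⇒0≤j-i (+≤+ (ℕ.<⇒≤ n<c))))
    step : ∀ n → + 0 ≤ℤ + c ℤ.* pair a n - + n ℤ.+ + c → + 0 ≤ℤ + c ℤ.* pair a (c + n) - + (c + n) ℤ.+ + c
    step n ih = subst (+ 0 ≤ℤ_)
      (trans (solve 3 (λ n c u → (c :* u :- n :+ c) := c :* ((con (+ 1) :- con (+ 0)) :+ u) :- (c :+ n) :+ c) refl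
               (+ n) (+ c) (pair a n))
        (cong (λ z → + c ℤ.* z - + (c + n) ℤ.+ + c)
          (sym (trans (pair-+ n 0<a) (cong (λ z → + 1 - z ℤ.+ pair a n) (deficit-beyond a (ℕ.m≤m+n c n)))))))
      ih

  -- Multiplying by `geom s` sums `pair a` along steps of length `s`, so the linear bound integrates
  -- to a quadratic one with leading term `n^2 / (2 p s)`, `p` being `a * suc a`. The lower-order
  -- terms are chosen so that both the base and the step close.
  geom-pair-lower : ∀ {a s} → 0 < a → 0 < s → ∀ n → + 0 ≤ℤ
    + 2 ℤ.* + (a * suc a) ℤ.* + s ℤ.* (geom s ⊛ pair a) n - + n ℤ.* + n
      ℤ.+ + 2 ℤ.* + (a * suc a) ℤ.* + n ℤ.+ + s ℤ.* + s
  geom-pair-lower {a} {s} 0<a 0<s = step-induction _ s 0<s base step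
    where
    p = a * suc a
    Y = geom s ⊛ pair a
    Y-unfold : Y ≋ pair a ⊕ qpow s ⊛ Y
    Y-unfold = geom-⊛-unfold (pair a) 0<s
    E : ℤ → ℤ → ℤ
    E n y = + 2 ℤ.* + p ℤ.* + s ℤ.* y - n ℤ.* n ℤ.+ + 2 ℤ.* + p ℤ.* n ℤ.+ + s ℤ.* + s
    base : ∀ n → n < s → + 0 ≤ℤ E (+ n) (Y n)
    base n n<s = subst (+ 0 ≤ℤ_)
      (solve 4 (λ n p s y → con (+ 2) :* p :* s :* y :+ (s :- n) :* (s :+ n) :+ con (+ 2) :* p :* n :=
                 con (+ 2) :* p :* s :* y :- n :* n :+ con (+ 2) :* p :* n :+ s :* s) refl (+ n) (+ p) (+ s) (Y n))
      (+-nonneg (+-nonneg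
        (*-nonneg (*-nonneg (*-nonneg (pos-nonneg 2) (pos-nonneg p)) (pos-nonneg s)) (⊛-nonneg (geom-nonneg s) (pair-nonneg a) n))
        (*-nonneg (ℤ.i≤j⇒0≤j-i (+≤+ (ℕ.<⇒≤ n<s))) (pos-nonneg (s + n))))
        (*-nonneg (*-nonneg (pos-nonneg 2) (pos-nonneg p)) (pos-nonneg n)))
    step : ∀ n → + 0 ≤ℤ E (+ n) (Y n) → + 0 ≤ℤ E (+ (s + n)) (Y (s + n))
    step n ih = subst (+ 0 ≤ℤ_)
      (trans (solve 5 (λ n p s y u →
                 (con (+ 2) :* p :* s :* y :- n :* n :+ con (+ 2) :* p :* n :+ s :* s) :+ con (+ 2) :* s :* (p :* u :- (s :+ n) :+ p) :+ s :* s :=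
                 con (+ 2) :* p :* s :* (u :+ y) :- (s :+ n) :* (s :+ n) :+ con (+ 2) :* p :* (s :+ n) :+ s :* s) refl
               (+ n) (+ p) (+ s) (Y n) (pair a (s + n)))
        (cong (E (+ (s + n))) (sym (unfold-+ {pair a} {Y} {s} n Y-unfold))))
      (+-nonneg (+-nonneg ih (*-nonneg (*-nonneg (pos-nonneg 2) (pos-nonneg s)) (pair-lower 0<a (s + n))))
        (*-nonneg (pos-nonneg s) (pos-nonneg s)))

  geom-pair-upper : ∀ {a c} → 0 < a → 0 < c → ∀ n → + 0 ≤ℤ
    + n ℤ.* + n ℤ.+ (+ 2 ℤ.* + (a * suc a) ℤ.+ + 2 ℤ.* + c) ℤ.* + n ℤ.+ + 2 ℤ.* + (a * suc a) ℤ.* + c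
      - + 2 ℤ.* + (a * suc a) ℤ.* + c ℤ.* (geom c ⊛ pair a) n
  geom-pair-upper {a} {c} 0<a 0<c = step-induction _ c 0<c base step
    where
    p = a * suc a
    X = geom c ⊛ pair a
    X-unfold : X ≋ pair a ⊕ qpow c ⊛ X
    X-unfold = geom-⊛-unfold (pair a) 0<c
    E : ℤ → ℤ → ℤ
    E n x = n ℤ.* n ℤ.+ (+ 2 ℤ.* + p ℤ.+ + 2 ℤ.* + c) ℤ.* n ℤ.+ + 2 ℤ.* + p ℤ.* + c - + 2 ℤ.* + p ℤ.* + c ℤ.* x
    base : ∀ n → n < c → + 0 ≤ℤ E (+ n) (X n)
    base n n<c = subst (+ 0 ≤ℤ_)
      (trans (solve 4 (λ n p c u → con (+ 2) :* c :* (n :+ p :- p :* u) :+ n :* n :+ con (+ 2) :* p :* n :=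
                 n :* n :+ (con (+ 2) :* p :+ con (+ 2) :* c) :* n :+ con (+ 2) :* p :* c :- con (+ 2) :* p :* c :* u) refl
                 (+ n) (+ p) (+ c) (pair a n))
        (cong (E (+ n)) (sym (unfold-< {pair a} {X} {c} X-unfold n<c))))
      (+-nonneg (+-nonneg
        (*-nonneg (*-nonneg (pos-nonneg 2) (pos-nonneg c)) (pair-upper 0<a n))
        (*-nonneg (pos-nonneg n) (pos-nonneg n)))
        (*-nonneg (*-nonneg (pos-nonneg 2) (pos-nonneg p)) (pos-nonneg n)))
    step : ∀ n → + 0 ≤ℤ E (+ n) (X n) → + 0 ≤ℤ E (+ (c + n)) (X (c + n))
    step n ih = subst (+ 0 ≤ℤ_)
      (trans (solve 5 (λ n p c x u →
                 (n :* n :+ (con (+ 2) :* p :+ con (+ 2) :* c) :* n :+ con (+ 2) :* p :* c :- con (+ 2) :* p :* c :* x)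
                   :+ con (+ 2) :* c :* ((c :+ n) :+ p :- p :* u) :+ c :* c :=
                 (c :+ n) :* (c :+ n) :+ (con (+ 2) :* p :+ con (+ 2) :* c) :* (c :+ n) :+ con (+ 2) :* p :* c
                   :- con (+ 2) :* p :* c :* (u :+ x)) refl
               (+ n) (+ p) (+ c) (X n) (pair a (c + n)))
        (cong (E (+ (c + n))) (sym (unfold-+ {pair a} {X} {c} n X-unfold))))
      (+-nonneg (+-nonneg ih (*-nonneg (*-nonneg (pos-nonneg 2) (pos-nonneg c)) (pair-upper 0<a (c + n))))
        (*-nonneg (pos-nonneg c) (pos-nonneg c)))

-- Quadratic growth of the kernel times a pair, and its consequences.

kernel : ℕ → ℕ → PS
kernel s c = qpow s ⊛ geom s ⊖ geom c

kernel-⊛ : ∀ {s} c f → 0 < s → kernel s c ⊛ f ≋ geom s ⊛ f ⊖ f ⊖ geom c ⊛ f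
kernel-⊛ {s} c f 0<s = begin
  (qpow s ⊛ geom s ⊖ geom c) ⊛ f
    ≈⟨ solve 4 (λ q g h f → (q :* g :- h) :* f := (con (+ 1) :+ q :* g) :* f :- f :- h :* f) (λ _ → refl)
         (qpow s) (geom s) (geom c) f ⟩
  (one ⊕ qpow s ⊛ geom s) ⊛ f ⊖ f ⊖ geom c ⊛ f
    ≈⟨ ⊖-cong {g = geom c ⊛ f} (⊖-cong {g = f} (⊛-congʳ f (≋-sym (geom-unfold 0<s))) ≋-refl) ≋-refl ⟩
  geom s ⊛ f ⊖ f ⊖ geom c ⊛ f ∎
  where open ≋-Reasoning
        open PS-Solver

-- By `kernel-⊛` the product is `geom s ⊛ pair a` minus `pair a` minus `geom c ⊛ pair a`. The
-- weights `c`, `2sc` and `s` bring the three bounds to the common denominator `2psc`. The quadratic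
-- terms then leave `(c - s) n^2`, and `s < c` allows lowering this to `n^2`.
kernel-pair-lower : ∀ {a s c} → 0 < a → 0 < s → s < c → let p = a * suc a in ∀ n → + 0 ≤ℤ
  + (2 * p * s * c) ℤ.* (kernel s c ⊛ pair a) n - + n ℤ.* + n
    ℤ.+ + (2 * p * c + 4 * s * c + 2 * p * s) ℤ.* + n ℤ.+ + (c * s * s + 4 * p * s * c)
kernel-pair-lower {a} {s} {c} 0<a 0<s s<c n = subst (+ 0 ≤ℤ_) eq
  (+-nonneg (+-nonneg (+-nonneg
    (*-nonneg (pos-nonneg c) (geom-pair-lower 0<a 0<s n))
    (*-nonneg (*-nonneg (*-nonneg (pos-nonneg 2) (pos-nonneg s)) (pos-nonneg c)) (pair-upper 0<a n)))
    (*-nonneg (pos-nonneg s) (geom-pair-upper 0<a (ℕ.≤-<-trans z≤n s<c) n)))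
    (*-nonneg (*-nonneg (ℤ.i≤j⇒0≤j-i (+≤+ s<c)) (pos-nonneg n)) (pos-nonneg n)))
  where
  p = a * suc a
  open ℤSolver.+-*-Solver
  pos-*₃ : ∀ x y z → + (x * y * z) ≡ + x ℤ.* + y ℤ.* + z
  pos-*₃ x y z = trans (ℤ.pos-* (x * y) z) (cong (ℤ._* + z) (ℤ.pos-* x y))
  pos-*₄ : ∀ x y z w → + (x * y * z * w) ≡ + x ℤ.* + y ℤ.* + z ℤ.* + w
  pos-*₄ x y z w = trans (ℤ.pos-* (x * y * z) w) (cong (ℤ._* + w) (pos-*₃ x y z))
  Y = (geom s ⊛ pair a) n
  X = (geom c ⊛ pair a) n
  u = pair a n
  F : ℤ → ℤ → ℤ → ℤ → ℤ
  F D q l m = D ℤ.* q - + n ℤ.* + n ℤ.+ l ℤ.* + n ℤ.+ m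
  eq : _ ≡ F (+ (2 * p * s * c)) ((kernel s c ⊛ pair a) n) (+ (2 * p * c + 4 * s * c + 2 * p * s)) (+ (c * s * s + 4 * p * s * c))
  eq = trans
    (solve 7 (λ n p s c y x u →
      c :* (con (+ 2) :* p :* s :* y :- n :* n :+ con (+ 2) :* p :* n :+ s :* s)
        :+ con (+ 2) :* s :* c :* (n :+ p :- p :* u)
        :+ s :* (n :* n :+ (con (+ 2) :* p :+ con (+ 2) :* c) :* n :+ con (+ 2) :* p :* c :- con (+ 2) :* p :* c :* x)
        :+ (c :- (con (+ 1) :+ s)) :* n :* n :=
      con (+ 2) :* p :* s :* c :* (y :- u :- x) :- n :* n
        :+ (con (+ 2) :* p :* c :+ con (+ 4) :* s :* c :+ con (+ 2) :* p :* s) :* n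
        :+ (c :* s :* s :+ con (+ 4) :* p :* s :* c)) refl
      (+ n) (+ p) (+ s) (+ c) Y X u)
    (trans
      (cong (λ q → F D′ q l′ m′) (sym (kernel-⊛ c (pair a) 0<s n)))
      (sym (trans
        (cong₂ (λ D l → F D Q l (+ (c * s * s + 4 * p * s * c)))
          (pos-*₄ 2 p s c) (cong₂ ℤ._+_ (cong₂ ℤ._+_ (pos-*₃ 2 p c) (pos-*₃ 4 s c)) (pos-*₃ 2 p s)))
        (cong (F D′ Q l′) (cong₂ ℤ._+_ (pos-*₃ c s s) (pos-*₄ 4 p s c))))))
    where
    Q = (kernel s c ⊛ pair a) n
    D′ = + 2 ℤ.* + p ℤ.* + s ℤ.* + c
    l′ = + 2 ℤ.* + p ℤ.* + c ℤ.+ + 4 ℤ.* + s ℤ.* + c ℤ.+ + 2 ℤ.* + p ℤ.* + s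
    m′ = + c ℤ.* + s ℤ.* + s ℤ.+ + 4 ℤ.* + p ℤ.* + s ℤ.* + c

QuadraticGrowth : ℕ → ℕ → ℕ → PS → Set
QuadraticGrowth d l m f = ∀ n → + 0 ≤ℤ + d ℤ.* f n - + n ℤ.* + n ℤ.+ + l ℤ.* + n ℤ.+ + m

*-cancel-nonneg : ∀ d {x} → 0 < d → + 0 ≤ℤ + d ℤ.* x → + 0 ≤ℤ x
*-cancel-nonneg (suc d) {x} _ h = ℤ.*-cancelˡ-≤-pos (+ 0) x (+ suc d) (subst (_≤ℤ + suc d ℤ.* x) (sym (ℤ.*-zeroʳ (+ suc d))) h)

-- This and the next two constants come from `d f(n) ≥ n^2 - l n - m`. The right side is nonnegative
-- once `n > l + m`. Before that it is at least `-(l n₀ + m) = -M`, and dividing by `d ≥ 1` keeps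
-- this bound. Adding `d (M + 1)` to `n₀` makes it at least `d (M + 1) n`.
nonneg-from : ℕ → ℕ → ℕ
nonneg-from l m = suc (l + m)

lower-bound : ℕ → ℕ → ℕ
lower-bound l m = l * nonneg-from l m + m

linear-from : ℕ → ℕ → ℕ → ℕ
linear-from d l m = nonneg-from l m + d * suc (lower-bound l m)

module _ {d l m : ℕ} {f : PS} (0<d : 0 < d) (h : QuadraticGrowth d l m f) where
  private
    n₀ = nonneg-from l m
    M = lower-bound l m
    w₀ = linear-from d l m
  open ℤSolver.+-*-Solver

  growth-nonneg : ∀ n → n₀ ≤ n → + 0 ≤ℤ f n
  growth-nonneg n n₀≤n = *-cancel-nonneg d 0<d (subst (+ 0 ≤ℤ_)
    (solve 4 (λ x n l m → (x :- n :* n :+ l :* n :+ m) :+ (n :* (n :- (con (+ 1) :+ (l :+ m))) :+ n :+ m :* (n :- con (+ 1))) := x) refl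
      (+ d ℤ.* f n) (+ n) (+ l) (+ m))
    (+-nonneg (h n) (+-nonneg (+-nonneg (*-nonneg (pos-nonneg n) (ℤ.i≤j⇒0≤j-i (+≤+ n₀≤n))) (pos-nonneg n))
      (*-nonneg (pos-nonneg m) (ℤ.i≤j⇒0≤j-i (+≤+ (ℕ.≤-trans (s≤s z≤n) n₀≤n)))))))

  growth-lower-bound : ∀ n → n < n₀ → + 0 ≤ℤ f n ℤ.+ + M
  growth-lower-bound n n<n₀ = *-cancel-nonneg d 0<d (subst (+ 0 ≤ℤ_)
    (trans (solve 7 (λ d q n k l m M → (d :* q :- n :* n :+ l :* n :+ m) :+ (n :* n :+ l :* (k :- n) :+ (d :- con (+ 1)) :* M) := (d :* (q :+ M) :+ ((l :* k :+ m) :- M))) refl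
       (+ d) (f n) (+ n) (+ n₀) (+ l) (+ m) (+ M))
      (trans (cong (λ z → + d ℤ.* (f n ℤ.+ + M) ℤ.+ (z - + M)) (cong (ℤ._+ + m) (sym (ℤ.pos-* l n₀))))
        (trans (+-congˡ (+ d ℤ.* (f n ℤ.+ + M)) (ℤ.+-inverseʳ (+ M))) (ℤ.+-identityʳ _))))
    (+-nonneg (h n) (+-nonneg (+-nonneg (*-nonneg (pos-nonneg n) (pos-nonneg n)) (*-nonneg (pos-nonneg l) (ℤ.i≤j⇒0≤j-i (+≤+ (ℕ.<⇒≤ n<n₀)))))
      (*-nonneg (ℤ.i≤j⇒0≤j-i (+≤+ 0<d)) (pos-nonneg M)))))

  growth-linear : ∀ n → w₀ ≤ n → + 0 ≤ℤ f n - + suc M ℤ.* + n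
  growth-linear n w₀≤n = *-cancel-nonneg d 0<d (subst (+ 0 ≤ℤ_)
    (solve 6 (λ d q n l m M → (d :* q :- n :* n :+ l :* n :+ m)
                :+ (n :* (n :- ((con (+ 1) :+ (l :+ m)) :+ d :* M)) :+ n :+ m :* (n :- con (+ 1)))
                := d :* (q :- M :* n)) refl
       (+ d) (f n) (+ n) (+ l) (+ m) (+ suc M))
    (+-nonneg (h n) (+-nonneg (+-nonneg
      (*-nonneg (pos-nonneg n) (subst (λ z → + 0 ≤ℤ + n - (+ n₀ ℤ.+ z)) (ℤ.pos-* d (suc M)) (ℤ.i≤j⇒0≤j-i (+≤+ w₀≤n)))) (pos-nonneg n))
      (*-nonneg (pos-nonneg m) (ℤ.i≤j⇒0≤j-i (+≤+ (ℕ.≤-trans (s≤s z≤n) w₀≤n)))))))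

-- Partitions into allowed parts, and compensation of negative terms.

-- The generating function of partitions into parts `y ≤ t` with `p y` true. A Boolean predicate
-- lets single parts be deleted from the middle of the range.
parts : (ℕ → Bool) → ℕ → PS
parts p zero    = one
parts p (suc t) = if p (suc t) then parts p t ⊛ geom (suc t) else parts p t

parts-nonneg : ∀ p t → Nonneg (parts p t)
parts-nonneg p zero    = one-nonneg
parts-nonneg p (suc t) with p (suc t)
... | true  = ⊛-nonneg (parts-nonneg p t) (geom-nonneg (suc t))
... | false = parts-nonneg p t

parts-0 : ∀ p t → parts p t 0 ≡ + 1
parts-0 p zero    = refl
parts-0 p (suc t) with p (suc t)
... | true  = cong₂ ℤ._*_ (parts-0 p t) (geom-∣ (suc t ℕ.∣0))
... | false = parts-0 p t

-- removals w t = Σ_{1 ≤ y ≤ t} q^{k y}, where k y is the least multiple of y exceeding w.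
removals : ℕ → ℕ → PS
removals w zero    = 0ₚ
removals w (suc t) = removals w t ⊕ qpow (suc (w / suc t) * suc t)

-- The largest size of a partition into parts `y ≤ t` in which every `y` occurs at most `w / y`
-- times.
leftover : ℕ → ℕ → ℕ
leftover w zero    = 0
leftover w (suc t) = leftover w t + w / suc t * suc t

-- A part `y` contributes at most `w`, and nothing if `y > w`. The bound `w * w` is free of `t`;
-- this matters because `t` grows with `L` while the final threshold may depend on `s` only.
leftover-≤ : ∀ w t → leftover w t ≤ t * w × leftover w t ≤ w * w
leftover-≤ w zero    = z≤n , z≤n
leftover-≤ w (suc t) with leftover-≤ w t | ℕ.<-≤-connex w (suc t)
... | a , b | inj₁ w<t = subst (λ x → x ≤ suc t * w × x ≤ w * w)
  (sym (trans (cong (λ z → leftover w t + z * suc t) (m<n⇒m/n≡0 w<t)) (ℕ.+-identityʳ _)))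
  (ℕ.≤-trans a (ℕ.m≤n+m (t * w) w) , b)
... | a , b | inj₂ t≤w = le , ℕ.≤-trans le (ℕ.*-monoˡ-≤ w t≤w)
  where
  le : leftover w t + w / suc t * suc t ≤ w + t * w
  le = subst (leftover w t + w / suc t * suc t ≤_) (ℕ.+-comm (t * w) w) (ℕ.+-mono-≤ a (m/n*n≤m w (suc t)))

removals-nonneg : ∀ w t → Nonneg (removals w t)
removals-nonneg w zero    n = +≤+ z≤n
removals-nonneg w (suc t) = ⊕-nonneg (removals-nonneg w t) (qpow-nonneg (suc (w / suc t) * suc t))

-- A partition of n > leftover w t has some part y with multiplicity above w / y; remove 1 + w / y copies of it.
removals-dominate : ∀ p w t n → leftover w t < n →
  + 0 ≤ℤ (removals w t ⊛ parts p t ⊖ parts p t) n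
removals-dominate p w zero    (suc n) _ = ℤ.≤-reflexive (sym (cong (_- + 0) (⊛-zeroˡ one (suc n))))
removals-dominate p w (suc t) n lt with p (suc t)
... | false = subst (+ 0 ≤ℤ_)
  (solve 3 (λ v q r → (v :* r :- r) :+ q :* r := (v :+ q) :* r :- r) (λ _ → refl) (removals w t) q (parts p t) n)
  (+-nonneg (removals-dominate p w t n (ℕ.≤-<-trans (ℕ.m≤m+n _ _) lt)) (⊛-nonneg (qpow-nonneg k) (parts-nonneg p t) n))
  where
  open PS-Solver
  k = suc (w / suc t) * suc t
  q = qpow k
... | true  = subst (+ 0 ≤ℤ_) (sym (eq n)) (+-nonneg
  (⊛-nonneg-beyond (leftover w t) (w / suc t * suc t) (removals-dominate p w t) (block-nonneg y j)
    (λ i lt′ → block-beyond y j (subst (y + w / suc t * suc t <_) (ℕ.+-comm y i) (ℕ.+-monoʳ-< y lt′))) n lt)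
  (⊛-nonneg (⊛-nonneg (removals-nonneg w t) (parts-nonneg p t)) (⊛-nonneg (qpow-nonneg k) (geom-nonneg y)) n))
  where
  open PS-Solver
  y = suc t
  j = suc (w / suc t)
  k = j * y
  q = qpow k
  g = geom y
  V = removals w t
  R = parts p t
  -- Split by the multiplicity of `y`: below `j`, the removal must come from the smaller parts, by
  -- induction; from `j` on, removing `j` copies of `y` accounts for the partition, so `R ⊛ (q ⊛ g)`
  -- cancels.
  eq : (V ⊕ q) ⊛ (R ⊛ g) ⊖ R ⊛ g ≋ (V ⊛ R ⊖ R) ⊛ block y j ⊕ (V ⊛ R) ⊛ (q ⊛ g)
  eq = begin
    (V ⊕ q) ⊛ (R ⊛ g) ⊖ R ⊛ g
      ≈⟨ solve 4 (λ v q r g → (v :+ q) :* (r :* g) :- r :* g := (v :* r :- r) :* g :+ r :* (q :* g)) (λ _ → refl) V q R g ⟩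
    (V ⊛ R ⊖ R) ⊛ g ⊕ R ⊛ (q ⊛ g)
      ≈⟨ ⊕-cong {g = R ⊛ (q ⊛ g)} (⊛-congˡ (V ⊛ R ⊖ R) (geom-split j (s≤s z≤n))) ≋-refl ⟩
    (V ⊛ R ⊖ R) ⊛ (block y j ⊕ q ⊛ g) ⊕ R ⊛ (q ⊛ g)
      ≈⟨ solve 5 (λ v q r g b → (v :* r :- r) :* (b :+ q :* g) :+ r :* (q :* g) := (v :* r :- r) :* b :+ (v :* r) :* (q :* g)) (λ _ → refl)
           V q R g (block y j) ⟩
    (V ⊛ R ⊖ R) ⊛ block y j ⊕ (V ⊛ R) ⊛ (q ⊛ g) ∎
    where open ≋-Reasoning

-- Splitting the all-ones series `geom 1` at degree `k` shows `block 1 k` to be the indicator of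
-- `n < k`, the form in which it is used below.
block-1-+ : ∀ k n → + 1 ≡ block 1 k n ℤ.+ (qpow k ⊛ geom 1) n
block-1-+ k n = trans (sym (geom-1 n)) (trans (geom-split k (s≤s z≤n) n)
  (+-congˡ (block 1 k n) (cong (λ m → (qpow m ⊛ geom 1) n) (ℕ.*-identityʳ k))))

block-1-< : ∀ {k n} → n < k → block 1 k n ≡ + 1
block-1-< {k} {n} n<k = sym (trans (block-1-+ k n) (trans (+-congˡ (block 1 k n) (qpow-⊛-< k (geom 1) n<k)) (ℤ.+-identityʳ _)))

block-1-≤1 : ∀ k n → block 1 k n ≤ℤ + 1
block-1-≤1 k n = subst (block 1 k n ≤ℤ_) (sym (block-1-+ k n))
  (subst (_≤ℤ block 1 k n ℤ.+ (qpow k ⊛ geom 1) n) (ℤ.+-identityʳ _)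
    (ℤ.+-monoʳ-≤ (block 1 k n) (⊛-nonneg (qpow-nonneg k) (geom-nonneg 1) n)))

qpow-⊛-≤1 : ∀ k f → (∀ n → f n ≤ℤ + 1) → ∀ n → (qpow k ⊛ f) n ≤ℤ + 1
qpow-⊛-≤1 k f b n with ℕ.<-≤-connex n k
... | inj₁ n<k = subst (_≤ℤ + 1) (sym (qpow-⊛-< k f n<k)) (+≤+ z≤n)
... | inj₂ k≤n = subst (λ m → (qpow k ⊛ f) m ≤ℤ + 1) (ℕ.m+[n∸m]≡n k≤n)
  (subst (_≤ℤ + 1) (sym (qpow-⊛-+ k f (n ∸ k))) (b (n ∸ k)))

removals-⊛-suc : ∀ w t f → removals w (suc t) ⊛ f ≋ removals w t ⊛ f ⊕ qpow (suc (w / suc t) * suc t) ⊛ f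
removals-⊛-suc w t f = ⊛-distribʳ f (removals w t) (qpow (suc (w / suc t) * suc t))

-- Each of the `t` monomials contributes at most 1, and the one for part `y` has exponent at least
-- `y`, so parts `y > n` contribute nothing. This bounds how many partitions can lead to the same
-- smaller one.
removals-⊛-≤ : ∀ w t f → (∀ n → f n ≤ℤ + 1) → ∀ n → (removals w t ⊛ f) n ≤ℤ + t × (removals w t ⊛ f) n ≤ℤ + n
removals-⊛-≤ w zero    f b n = ℤ.≤-reflexive (⊛-zeroˡ f n) , subst (_≤ℤ + n) (sym (⊛-zeroˡ f n)) (+≤+ z≤n)
removals-⊛-≤ w (suc t) f b n with removals-⊛-≤ w t f b n | ℕ.<-≤-connex n (suc t)
... | c , d | inj₁ n<t = subst (λ x → x ≤ℤ + suc t × x ≤ℤ + n)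
  (sym (trans (removals-⊛-suc w t f n) (trans (+-congˡ ((removals w t ⊛ f) n) (qpow-⊛-< (suc (w / suc t) * suc t) f (ℕ.<-≤-trans n<t (ℕ.m≤m+n (suc t) (w / suc t * suc t))))) (ℤ.+-identityʳ _))))
  (ℤ.≤-trans c (+≤+ (ℕ.n≤1+n t)) , d)
... | c , d | inj₂ t≤n = le , ℤ.≤-trans le (+≤+ t≤n)
  where
  le : (removals w (suc t) ⊛ f) n ≤ℤ + suc t
  le = subst₂ _≤ℤ_ (sym (removals-⊛-suc w t f n)) (ℤ.+-comm (+ t) (+ 1)) (ℤ.+-mono-≤ c (qpow-⊛-≤1 _ f b n))

m<[1+m/n]*n : ∀ m n → m < suc (m / suc n) * suc n
m<[1+m/n]*n m n = subst (_< suc (m / suc n) * suc n) (sym (m≡m%n+[m/n]*n m (suc n)))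
  (ℕ.+-monoˡ-< (m / suc n * suc n) (m%n<n m (suc n)))

-- Every exponent in `removals w t` exceeds `w`.
removals-⊛-0 : ∀ w t f n → n ≤ w → (removals w t ⊛ f) n ≡ + 0
removals-⊛-0 w zero    f n _   = ⊛-zeroˡ f n
removals-⊛-0 w (suc t) f n n≤w = trans (removals-⊛-suc w t f n)
  (cong₂ ℤ._+_ (removals-⊛-0 w t f n n≤w) (qpow-⊛-< _ f (ℕ.≤-<-trans n≤w (m<[1+m/n]*n w t))))

⊛-≥-last : ∀ {f g} → Nonneg f → Nonneg g → ∀ n → f n ℤ.* g 0 ≤ℤ (f ⊛ g) n
⊛-≥-last p q zero = ℤ.≤-refl
⊛-≥-last {f} {g} p q (suc n) = subst₂ _≤ℤ_ (ℤ.+-identityˡ _) (sym (⊛-suc-last f g n))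
  (ℤ.+-monoˡ-≤ (f (suc n) ℤ.* g 0) (⊛-nonneg p (λ i → q (suc i)) n))

-- Write `f ⊛ R` as `Z ⊛ R` plus `M` times `(V ⊛ R ⊖ R) ⊛ E`, where `E` indicates degrees below
-- `n₀`. The second term is nonnegative in degree `N` by `removals-dominate`. In `Z`, adding `M E`
-- repairs the negative values of `f`; the charge `M (V ⊛ E)` vanishes up to `w₀` and is at most
-- `M n` afterwards, where `f` is at least `(M + 1) n`. So `Z` is nonnegative, and the empty
-- partition alone gives `Z N ≥ N`.
growth-parts : ∀ {d l m f} → 0 < d → QuadraticGrowth d l m f → ∀ p t n →
  linear-from d l m * linear-from d l m + nonneg-from l m < n → + n ≤ℤ (f ⊛ parts p t) n
growth-parts {d} {l} {m} {f} 0<d h p t N lt = subst (+ N ≤ℤ_) (sym (eq N))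
  (subst (_≤ℤ (Z ⊛ R ⊕ μ ⊛ ((V ⊛ R ⊖ R) ⊛ E)) N) (ℤ.+-identityʳ (+ N)) (ℤ.+-mono-≤ bound
    (subst (+ 0 ≤ℤ_) (sym (μ-⊛ ((V ⊛ R ⊖ R) ⊛ E) N)) (*-nonneg (pos-nonneg M)
      (⊛-nonneg-beyond (leftover w₀ t) n₀ (removals-dominate p w₀ t) (block-nonneg 1 n₀)
        (λ i n₀<i → block-beyond 1 n₀ (subst (_< i + 1) (sym (ℕ.*-identityʳ n₀)) (ℕ.<-≤-trans n₀<i (ℕ.m≤m+n i 1))))
        N (ℕ.≤-<-trans (ℕ.+-monoˡ-≤ n₀ (proj₂ (leftover-≤ w₀ t))) lt))))))
  where
  n₀ = nonneg-from l m
  M = lower-bound l m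
  w₀ = linear-from d l m
  R = parts p t
  V = removals w₀ t
  E = block 1 n₀
  -- The scalar `M` as a series, so that the ring solver can treat it as a variable.
  μ = (+ M) · one
  Z = f ⊕ μ ⊛ E ⊖ μ ⊛ (V ⊛ E)
  μ-⊛ : ∀ g → μ ⊛ g ≋ (+ M) · g
  μ-⊛ g n = trans (·-⊛ (+ M) one g n) (cong (+ M ℤ.*_) (⊛-identityˡ g n))
  Z-≡ : ∀ n → Z n ≡ f n ℤ.+ + M ℤ.* E n - + M ℤ.* (V ⊛ E) n
  Z-≡ n = cong₂ _-_ (+-congˡ (f n) (μ-⊛ E n)) (μ-⊛ (V ⊛ E) n)
  Z-large : ∀ n → w₀ ≤ n → + n ≤ℤ Z n
  Z-large n w₀≤n = ℤ.0≤i-j⇒j≤i (subst (+ 0 ≤ℤ_)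
    (trans (solve 5 (λ q e v m n → (q :- (con (+ 1) :+ m) :* n) :+ (m :* e :+ m :* (n :- v)) := (q :+ m :* e :- m :* v) :- n) refl
              (f n) (E n) ((V ⊛ E) n) (+ M) (+ n))
       (cong (_- + n) (sym (Z-≡ n))))
    (+-nonneg (growth-linear 0<d h n w₀≤n) (+-nonneg (*-nonneg (pos-nonneg M) (block-nonneg 1 n₀ n))
      (*-nonneg (pos-nonneg M) (ℤ.i≤j⇒0≤j-i (proj₂ (removals-⊛-≤ w₀ t E (block-1-≤1 n₀) n)))))))
    where open ℤSolver.+-*-Solver
  Z-nonneg : Nonneg Z
  Z-nonneg n with ℕ.<-≤-connex n w₀
  ... | inj₂ w₀≤n = ℤ.≤-trans (pos-nonneg n) (Z-large n w₀≤n)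
  ... | inj₁ n<w₀ = subst (+ 0 ≤ℤ_)
    (sym (trans (Z-≡ n) (trans (cong (λ v → f n ℤ.+ + M ℤ.* E n - + M ℤ.* v) (removals-⊛-0 w₀ t E n (ℕ.<⇒≤ n<w₀)))
      (trans (cong (λ v → f n ℤ.+ + M ℤ.* E n - v) (ℤ.*-zeroʳ (+ M))) (ℤ.+-identityʳ _)))))
    small
    where
    small : + 0 ≤ℤ f n ℤ.+ + M ℤ.* E n
    small with ℕ.<-≤-connex n n₀
    ... | inj₁ n<n₀ = subst (λ e → + 0 ≤ℤ f n ℤ.+ e) (sym (trans (cong (+ M ℤ.*_) (block-1-< n<n₀)) (ℤ.*-identityʳ (+ M))))
      (growth-lower-bound 0<d h n n<n₀)
    ... | inj₂ n₀≤n = +-nonneg (growth-nonneg 0<d h n n₀≤n) (*-nonneg (pos-nonneg M) (block-nonneg 1 n₀ n))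
  w₀≤N : w₀ ≤ N
  w₀≤N = ℕ.≤-trans (ℕ.m≤m*n w₀ w₀) (ℕ.≤-trans (ℕ.m≤m+n (w₀ * w₀) n₀) (ℕ.<⇒≤ lt))
  bound : + N ≤ℤ (Z ⊛ R) N
  bound = ℤ.≤-trans (Z-large N w₀≤N) (subst (_≤ℤ (Z ⊛ R) N) (trans (cong (Z N ℤ.*_) (parts-0 p t)) (ℤ.*-identityʳ (Z N)))
    (⊛-≥-last Z-nonneg (parts-nonneg p t) N))
  eq : f ⊛ R ≋ Z ⊛ R ⊕ μ ⊛ ((V ⊛ R ⊖ R) ⊛ E)
  eq = solve 5 (λ f r v e m → f :* r := (f :+ m :* e :- m :* (v :* e)) :* r :+ m :* ((v :* r :- r) :* e)) (λ _ → refl) f R V E μ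
    where open PS-Solver

-- Isolating single factors.

-- Names one recursion step of `parts`, so that its Boolean can be rewritten by `cong`.
factor : Bool → ℕ → PS → PS
factor b y f = if b then f ⊛ geom y else f

factor-cong : ∀ b y {f g} → f ≋ g → factor b y f ≋ factor b y g
factor-cong true  y e = ⊛-congʳ (geom y) e
factor-cong false y e = e

factor-⊛ : ∀ b y f g → factor b y (f ⊛ g) ≋ factor b y f ⊛ g
factor-⊛ false y f g = ≋-refl
factor-⊛ true  y f g = solve 3 (λ f g h → f :* g :* h := f :* h :* g) (λ _ → refl) f g (geom y)
  where open PS-Solver

parts-cong : ∀ {p p′} t → (∀ y → y ≤ t → p y ≡ p′ y) → parts p t ≋ parts p′ t
parts-cong zero    e = ≋-refl
parts-cong {p} {p′} (suc t) e = ≋-trans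
  (factor-cong (p (suc t)) (suc t) (parts-cong t (λ y y≤t → e y (ℕ.m≤n⇒m≤1+n y≤t))))
  (λ n → cong (λ b → factor b (suc t) (parts p′ t) n) (e (suc t) ℕ.≤-refl))

parts-suc : ∀ {p} t → p (suc t) ≡ true → parts p (suc t) ≋ parts p t ⊛ geom (suc t)
parts-suc {p} t e n = cong (λ b → factor b (suc t) (parts p t) n) e

parts-skip : ∀ {p} t → p (suc t) ≡ false → parts p (suc t) ≋ parts p t
parts-skip {p} t e n = cong (λ b → factor b (suc t) (parts p t) n) e

without : (ℕ → Bool) → ℕ → ℕ → Bool
without p x y = if ⌊ y ℕ.≟ x ⌋ then false else p y

without-≡ : ∀ p x → without p x x ≡ false
without-≡ p x with x ℕ.≟ x
... | yes _   = refl
... | no  x≢x = ⊥-elim (x≢x refl)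

without-≢ : ∀ p {x y} → y ≢ x → without p x y ≡ p y
without-≢ p {x} {y} y≢x with y ℕ.≟ x
... | yes y≡x = ⊥-elim (y≢x y≡x)
... | no  _   = refl

parts-extract : ∀ {p x} t → 0 < x → x ≤ t → p x ≡ true → parts p t ≋ parts (without p x) t ⊛ geom x
parts-extract {p} {x} zero    0<x x≤t px = ⊥-elim (ℕ.<⇒≱ 0<x x≤t)
parts-extract {p} {x} (suc t) 0<x x≤t px with ℕ.m≤n⇒m<n∨m≡n x≤t
... | inj₁ (s≤s x≤t′) = ≋-trans (factor-cong (p (suc t)) (suc t) (parts-extract t 0<x x≤t′ px))
  (≋-trans (factor-⊛ (p (suc t)) (suc t) (parts (without p x) t) (geom x))
    (λ n → cong (λ b → (factor b (suc t) (parts (without p x) t) ⊛ geom x) n) (sym (without-≢ p (ℕ.>⇒≢ (s≤s x≤t′))))))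
... | inj₂ refl = ≋-trans (parts-suc t px) (⊛-congʳ (geom x) (≋-trans
  (parts-cong t (λ y y≤t → sym (without-≢ p (ℕ.<⇒≢ (s≤s y≤t)))))
  (≋-sym (parts-skip t (without-≡ p x)))))

above : ℕ → ℕ → Bool
above s y = ⌊ s ℕ.<? y ⌋

above-true : ∀ {s y} → s < y → above s y ≡ true
above-true {s} {y} s<y with s ℕ.<? y
... | yes _   = refl
... | no  s≮y = ⊥-elim (s≮y s<y)

above-false : ∀ {s y} → y ≤ s → above s y ≡ false
above-false {s} {y} y≤s with s ℕ.<? y
... | yes s<y = ⊥-elim (ℕ.<⇒≱ s<y y≤s)
... | no  _   = refl

parts-above-≤ : ∀ {s} t → t ≤ s → parts (above s) t ≋ one
parts-above-≤ zero    _   = ≋-refl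
parts-above-≤ (suc t) t<s = ≋-trans (parts-skip t (above-false t<s)) (parts-above-≤ t (ℕ.<⇒≤ t<s))

invPoch-parts : ∀ s m → invPoch (suc s) m ≋ parts (above s) (s + m)
invPoch-parts s zero    = ≋-sym (parts-above-≤ (s + 0) (ℕ.≤-reflexive (ℕ.+-identityʳ s)))
invPoch-parts s (suc m) = ≋-trans (⊛-congʳ (geom (suc (s + m))) (invPoch-parts s m))
  (≋-sym (≋-trans (λ n → cong (λ t → parts (above s) t n) (ℕ.+-suc s m))
    (parts-suc (s + m) (above-true (s≤s (ℕ.m≤m+n s m))))))

invPoch-head : ∀ s m → invPoch s (suc m) ≋ geom s ⊛ invPoch (suc s) m
invPoch-head s zero n = trans (⊛-comm one (geom (s + 0)) n) (cong (λ j → (geom j ⊛ one) n) (ℕ.+-identityʳ s))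
invPoch-head s (suc m) = begin
  invPoch s (suc m) ⊛ geom (s + suc m)
    ≈⟨ ⊛-cong (invPoch-head s m) (λ n → cong (λ j → geom j n) (ℕ.+-suc s m)) ⟩
  geom s ⊛ invPoch (suc s) m ⊛ geom (suc s + m)
    ≈⟨ ⊛-assoc (geom s) (invPoch (suc s) m) (geom (suc s + m)) ⟩
  geom s ⊛ invPoch (suc s) (suc m) ∎
  where open ≋-Reasoning

-- From `H` to the kernel, and lowering the kernel index.

-- The numerator `1 - q^L` cancels the factor `geom L` in the first summand of `H` only, so `f` can
-- be taken out of the difference.
H-kernel : ∀ {L s f} → 0 < L → invPoch (suc s) L ≋ f ⊛ geom L → H L s L ≋ f ⊛ kernel s L ⊕ one
H-kernel {L} {s} {f} 0<L e = begin
  qpow s ⊛ (one ⊖ qpow L) ⊛ invPoch s (suc L) ⊖ (invPoch (suc s) L ⊖ one)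
    ≈⟨ ⊖-cong (⊛-congˡ (qpow s ⊛ (one ⊖ qpow L)) (≋-trans (invPoch-head s L) (⊛-congˡ (geom s) e))) (⊖-cong {g = one} e ≋-refl) ⟩
  qpow s ⊛ (one ⊖ qpow L) ⊛ (geom s ⊛ (f ⊛ geom L)) ⊖ (f ⊛ geom L ⊖ one)
    ≈⟨ solve 5 (λ x y g f h → x :* (con (+ 1) :- y) :* (g :* (f :* h)) :- (f :* h :- con (+ 1))
                  := x :* g :* f :* (h :- y :* h) :- (f :* h :- con (+ 1))) (λ _ → refl)
         (qpow s) (qpow L) (geom s) f (geom L) ⟩
  qpow s ⊛ geom s ⊛ f ⊛ (geom L ⊖ qpow L ⊛ geom L) ⊖ (f ⊛ geom L ⊖ one)
    ≈⟨ ⊖-cong {g = f ⊛ geom L ⊖ one} (⊛-congˡ (qpow s ⊛ geom s ⊛ f) (⊖-cong {g = qpow L ⊛ geom L} (geom-unfold 0<L) ≋-refl)) ≋-refl ⟩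
  qpow s ⊛ geom s ⊛ f ⊛ (one ⊕ qpow L ⊛ geom L ⊖ qpow L ⊛ geom L) ⊖ (f ⊛ geom L ⊖ one)
    ≈⟨ solve 5 (λ x y g f h → x :* g :* f :* (con (+ 1) :+ y :* h :- y :* h) :- (f :* h :- con (+ 1))
                  := f :* (x :* g :- h) :+ con (+ 1)) (λ _ → refl)
         (qpow s) (qpow L) (geom s) f (geom L) ⟩
  f ⊛ kernel s L ⊕ one ∎
  where open ≋-Reasoning
        open PS-Solver

kernel-excess : ℕ → ℕ → PS
kernel-excess s c = qpow s ⊛ qpow s ⊛ qpow c ⊛ geom s ⊛ geom (s + c)

kernel-excess-nonneg : ∀ s c → Nonneg (kernel-excess s c)
kernel-excess-nonneg s c = ⊛-nonneg (⊛-nonneg (⊛-nonneg (⊛-nonneg (qpow-nonneg s) (qpow-nonneg s)) (qpow-nonneg c)) (geom-nonneg s)) (geom-nonneg (s + c))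

-- An identity of rational functions in `x = q^s` and `y = q^c`. Without division it holds modulo
-- the relations `g = 1 + x g`, `h = 1 + y h`, `k = 1 + x y k`; `A`, `B`, `C` are the cofactors of
-- these relations.
kernel-descent : ∀ {s c} → 0 < s → 0 < c → kernel s (s + c) ⊛ geom c ≋ kernel s c ⊕ kernel-excess s c
kernel-descent {s} {c} 0<s 0<c = begin
  (x ⊛ g ⊖ k) ⊛ h
    ≈⟨ solve 5 (λ x y g h k →
         (x :* g :- k) :* h :=
         (x :* g :- h) :+ x :* x :* y :* g :* k
           :+ (x :* y :* h :* k :* (g :- (con (+ 1) :+ x :* g))
               :+ (x :* g :+ x :* x :* y :* g :* k) :* (h :- (con (+ 1) :+ y :* h))
               :+ (:- h :- x :* y :* h :* g) :* (k :- (con (+ 1) :+ x :* y :* k))))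
         (λ _ → refl) x y g h k ⟩
  kernel s c ⊕ kernel-excess s c ⊕ (A ⊛ (g ⊖ (one ⊕ x ⊛ g)) ⊕ B ⊛ (h ⊖ (one ⊕ y ⊛ h)) ⊕ C ⊛ (k ⊖ (one ⊕ x ⊛ y ⊛ k)))
    ≈⟨ ⊕-cong {kernel s c ⊕ kernel-excess s c} ≋-refl
         (⊕-cong (⊕-cong (⊛-congˡ A (vanish (geom-unfold 0<s))) (⊛-congˡ B (vanish (geom-unfold 0<c)))) (⊛-congˡ C (vanish k-unfold))) ⟩
  kernel s c ⊕ kernel-excess s c ⊕ (A ⊛ 0ₚ ⊕ B ⊛ 0ₚ ⊕ C ⊛ 0ₚ)
    ≈⟨ solve 4 (λ z a b c → z :+ (a :* con (+ 0) :+ b :* con (+ 0) :+ c :* con (+ 0)) := z) (λ _ → refl)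
         (kernel s c ⊕ kernel-excess s c) A B C ⟩
  kernel s c ⊕ kernel-excess s c ∎
  where
  open ≋-Reasoning
  open PS-Solver
  x = qpow s
  y = qpow c
  g = geom s
  h = geom c
  k = geom (s + c)
  A = x ⊛ y ⊛ h ⊛ k
  B = x ⊛ g ⊕ x ⊛ x ⊛ y ⊛ g ⊛ k
  C = ⊝ h ⊖ x ⊛ y ⊛ h ⊛ g
  vanish : ∀ {u v} → u ≋ v → u ⊖ v ≋ 0ₚ
  vanish e n = ℤ.i≡j⇒i-j≡0 (e n)
  k-unfold : k ≋ one ⊕ x ⊛ y ⊛ k
  k-unfold = ≋-trans (geom-unfold (ℕ.<-≤-trans 0<s (ℕ.m≤m+n s c)))
    (⊕-cong {one} ≋-refl (⊛-congʳ k (≋-sym (qpow-+ s c))))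

-- The bound of `growth-parts` for the constants of `kernel-pair-lower`, with `p` standing for
-- `a * suc a`.
threshold : ℕ → ℕ → ℕ → ℕ
threshold p s c = w * w + nonneg-from l m
  where
  l = 2 * p * c + 4 * s * c + 2 * p * s
  m = c * s * s + 4 * p * s * c
  w = linear-from (2 * p * s * c) l m

parts-kernel : ∀ {p a s c} t → 0 < a → a < t → p a ≡ true → p (suc a) ≡ true → 0 < s → s < c →
  ∀ n → threshold (a * suc a) s c < n → + n ≤ℤ (parts p t ⊛ kernel s c) n
parts-kernel {p} {a} {s} {c} t 0<a a<t pa pa′ 0<s s<c n lt =
  subst (+ n ≤ℤ_) (sym (eq n)) (growth-parts {2 * (a * suc a) * s * c} {2 * (a * suc a) * c + 4 * s * c + 2 * (a * suc a) * s}
    {c * s * s + 4 * (a * suc a) * s * c} {kernel s c ⊛ pair a} D>0 (kernel-pair-lower 0<a 0<s s<c) p′ t n lt)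
  where
  open ≋-Reasoning
  open PS-Solver
  p′ = without (without p (suc a)) a
  D>0 : 0 < 2 * (a * suc a) * s * c
  D>0 = ℕ.*-mono-≤ (ℕ.*-mono-≤ (ℕ.*-mono-≤ (s≤s {n = 1} z≤n) (ℕ.*-mono-≤ 0<a (s≤s {n = a} z≤n))) 0<s) (ℕ.≤-<-trans z≤n s<c)
  eq : parts p t ⊛ kernel s c ≋ (kernel s c ⊛ pair a) ⊛ parts p′ t
  eq = begin
    parts p t ⊛ kernel s c
      ≈⟨ ⊛-congʳ (kernel s c) (≋-trans (parts-extract t (s≤s z≤n) a<t pa′)
           (⊛-congʳ (geom (suc a)) (parts-extract t 0<a (ℕ.<⇒≤ a<t) (trans (without-≢ p (ℕ.<⇒≢ ℕ.≤-refl)) pa)))) ⟩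
    parts p′ t ⊛ geom a ⊛ geom (suc a) ⊛ kernel s c
      ≈⟨ solve 4 (λ f g h k → f :* g :* h :* k := k :* (g :* h) :* f) (λ _ → refl) (parts p′ t) (geom a) (geom (suc a)) (kernel s c) ⟩
    (kernel s c ⊛ pair a) ⊛ parts p′ t ∎

-- The upper bound on `c′` makes the threshold depend on `s` alone; the lower bound keeps `s + 1`
-- and `s + 2` from being used up by the descent.
Descended : ℕ → ℕ → (ℕ → Bool) → ℕ → Set
Descended s t p c = ∃ λ c′ → ∃ λ p′ → s + 3 ≤ c′ × c′ ≤ 2 * s + 2 ×
  p′ (suc s) ≡ true × p′ (suc (suc s)) ≡ true × parts p′ t ⊛ kernel s c′ ≼ parts p t ⊛ kernel s c

descend : ∀ {s} t fuel p c → c ≤ fuel → 0 < s → s + 3 ≤ c → c ≤ t →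
  (∀ j → s < j → j < c → p j ≡ true) → Descended s t p c
descend {s} t fuel p c c≤fuel 0<s s+3≤c c≤t all with ℕ.<-≤-connex (2 * s + 2) c
... | inj₂ small = c , p , s+3≤c , small , all (suc s) ℕ.≤-refl 2+s≤c , all (suc (suc s)) (ℕ.n≤1+n _) 3+s≤c , λ _ → ℤ.≤-refl
  where
  3+s≤c : 3 + s ≤ c
  3+s≤c = subst (_≤ c) (ℕ.+-comm s 3) s+3≤c
  2+s≤c : 2 + s ≤ c
  2+s≤c = ℕ.≤-trans (ℕ.n≤1+n _) 3+s≤c
descend {s} t zero p c c≤fuel 0<s s+3≤c c≤t all | inj₁ large = ⊥-elim (ℕ.<⇒≱ large (ℕ.≤-trans c≤fuel z≤n))
descend {s} t (suc fuel) p c c≤fuel 0<s s+3≤c c≤t all | inj₁ large =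
  let c″ , p″ , b₁ , b₂ , t₁ , t₂ , le = descend t fuel p′ c′ (ℕ.≤-pred (ℕ.≤-trans c′<c c≤fuel)) 0<s s+3≤c′ (ℕ.≤-trans (ℕ.<⇒≤ c′<c) c≤t) all′
  in c″ , p″ , b₁ , b₂ , t₁ , t₂ , λ n → ℤ.≤-trans (le n) (step n)
  where
  c′ = c ∸ s
  p′ = without p c′
  s≤c : s ≤ c
  s≤c = ℕ.≤-trans (ℕ.m≤m+n s 3) s+3≤c
  c′<c : c′ < c
  c′<c = ℕ.∸-monoʳ-< 0<s s≤c
  -- From `c > 2s + 2` follows `c ∸ s ≥ s + 3`, so a step never jumps below the target interval.
  s+3≤c′ : s + 3 ≤ c′
  s+3≤c′ = ℕ.m+n≤o⇒m≤o∸n (s + 3) (subst (_≤ c) eq large)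
    where
    open ℕSolver.+-*-Solver
    eq : suc (2 * s + 2) ≡ s + 3 + s
    eq = solve 1 (λ s → con 1 :+ (con 2 :* s :+ con 2) := s :+ con 3 :+ s) refl s
  s<c′ : s < c′
  s<c′ = ℕ.<-≤-trans (ℕ.m<m+n s (s≤s z≤n)) s+3≤c′
  0<c′ : 0 < c′
  0<c′ = ℕ.≤-<-trans z≤n s<c′
  all′ : ∀ j → s < j → j < c′ → p′ j ≡ true
  all′ j s<j j<c′ = trans (without-≢ p (ℕ.<⇒≢ j<c′)) (all j s<j (ℕ.<-trans j<c′ c′<c))
  R′ = parts p′ t
  eq : parts p t ⊛ kernel s c ≋ R′ ⊛ kernel s c′ ⊕ R′ ⊛ kernel-excess s c′
  eq = begin
    parts p t ⊛ kernel s c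
      ≈⟨ ⊛-cong (parts-extract t 0<c′ (ℕ.≤-trans (ℕ.<⇒≤ c′<c) c≤t) (all c′ s<c′ c′<c)) (λ n → cong (λ d → kernel s d n) (sym (ℕ.m+[n∸m]≡n s≤c))) ⟩
    R′ ⊛ geom c′ ⊛ kernel s (s + c′)
      ≈⟨ solve 3 (λ r g k → r :* g :* k := r :* (k :* g)) (λ _ → refl) R′ (geom c′) (kernel s (s + c′)) ⟩
    R′ ⊛ (kernel s (s + c′) ⊛ geom c′)
      ≈⟨ ⊛-congˡ R′ (kernel-descent 0<s 0<c′) ⟩
    R′ ⊛ (kernel s c′ ⊕ kernel-excess s c′)
      ≈⟨ ⊛-distribˡ R′ (kernel s c′) (kernel-excess s c′) ⟩
    R′ ⊛ kernel s c′ ⊕ R′ ⊛ kernel-excess s c′ ∎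
    where open ≋-Reasoning
          open PS-Solver
  step : R′ ⊛ kernel s c′ ≼ parts p t ⊛ kernel s c
  step n = subst ((R′ ⊛ kernel s c′) n ≤ℤ_) (sym (eq n))
    (subst (_≤ℤ (R′ ⊛ kernel s c′ ⊕ R′ ⊛ kernel-excess s c′) n) (ℤ.+-identityʳ _)
      (ℤ.+-monoʳ-≤ ((R′ ⊛ kernel s c′) n) (⊛-nonneg (parts-nonneg p′ t) (kernel-excess-nonneg s c′) n)))

-- Numerical estimates.

-- A nonnegative quotient `k` satisfies `k ≤ k d ≤ i`. This crude bound suffices because the
-- coefficient in question is shown to be at least `N` itself.
/ℕ-upper : ∀ i d .{{_ : NonZero d}} n → i ≤ℤ + n → i /ℕ d ≤ℤ + n
/ℕ-upper i d n i≤n with i /ℕ d | [n/ℕd]*d≤n i d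
... | + k       | le = ℤ.≤-trans (subst (+ k ≤ℤ_) (ℤ.pos-* k d) (+≤+ (ℕ.m≤m*n k d))) (ℤ.≤-trans le i≤n)
... | ℤ.-[1+ k ] | _  = ℤ.-≤+

-- Polynomial sizes are tracked as exponents of `z`: a sum costs one exponent, a product adds
-- exponents, and the constants 2 and 4 count as `z ^ 1`.
module PowerBounds (z : ℕ) (4≤z : 4 ≤ z) where
  instance
    z-nonZero : NonZero z
    z-nonZero = ℕ.>-nonZero (ℕ.≤-trans (s≤s z≤n) 4≤z)

  weaken : ∀ {x} i j → x ≤ z ^ i → i ≤ j → x ≤ z ^ j
  weaken i j x≤ i≤j = ℕ.≤-trans x≤ (ℕ.^-monoʳ-≤ z i≤j)

  sum-≤ : ∀ {x y} i → x ≤ z ^ i → y ≤ z ^ i → x + y ≤ z ^ suc i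
  sum-≤ {x} {y} i x≤ y≤ = ℕ.≤-trans (ℕ.+-mono-≤ x≤ (ℕ.≤-trans y≤ (ℕ.≤-reflexive (sym (ℕ.+-identityʳ (z ^ i))))))
    (ℕ.*-monoˡ-≤ (z ^ i) (ℕ.≤-trans (s≤s (s≤s z≤n)) 4≤z))

  product-≤ : ∀ {x y} i j → x ≤ z ^ i → y ≤ z ^ j → x * y ≤ z ^ (i + j)
  product-≤ i j x≤ y≤ = ℕ.≤-trans (ℕ.*-mono-≤ x≤ y≤) (ℕ.≤-reflexive (sym (ℕ.^-distribˡ-+-* z i j)))

  base-≤ : ∀ {x} → x ≤ z → x ≤ z ^ 1
  base-≤ x≤z = ℕ.≤-trans x≤z (ℕ.≤-reflexive (sym (ℕ.*-identityʳ z)))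

  -- The exponent 46 arises from `w ≤ z ^ 22`: squaring gives 44, adding `n₀` gives 45, and adding 1
  -- for strictness gives 46.
  threshold-< : ∀ {p s c} → p ≤ z ^ 2 → s ≤ z → c ≤ z → threshold p s c < z ^ 46
  threshold-< {p} {s} {c} p≤ s≤z c≤z =
    sum-≤ 45 (weaken 0 45 ℕ.≤-refl z≤n) (sum-≤ 44 (product-≤ 22 22 w≤ w≤) (weaken 8 44 n₀≤ (ℕ.m≤m+n 8 36)))
    where
    l = 2 * p * c + 4 * s * c + 2 * p * s
    m = c * s * s + 4 * p * s * c
    s≤ : s ≤ z ^ 1
    s≤ = base-≤ s≤z
    c≤ : c ≤ z ^ 1
    c≤ = base-≤ c≤z
    2≤ : 2 ≤ z ^ 1
    2≤ = base-≤ (ℕ.≤-trans (s≤s (s≤s z≤n)) 4≤z)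
    4≤ : 4 ≤ z ^ 1
    4≤ = base-≤ 4≤z
    2p≤ : 2 * p ≤ z ^ 3
    2p≤ = product-≤ 1 2 2≤ p≤
    l≤ : l ≤ z ^ 6
    l≤ = sum-≤ 5 (sum-≤ 4 (product-≤ 3 1 2p≤ c≤) (weaken 3 4 (product-≤ 2 1 (product-≤ 1 1 4≤ s≤) c≤) (ℕ.n≤1+n 3)))
      (weaken 4 5 (product-≤ 3 1 2p≤ s≤) (ℕ.n≤1+n 4))
    m≤ : m ≤ z ^ 6
    m≤ = sum-≤ 5 (weaken 3 5 (product-≤ 2 1 (product-≤ 1 1 c≤ s≤) s≤) (ℕ.m≤m+n 3 2))
      (product-≤ 4 1 (product-≤ 3 1 (product-≤ 1 2 4≤ p≤) s≤) c≤)
    n₀≤ : nonneg-from l m ≤ z ^ 8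
    n₀≤ = sum-≤ 7 (weaken 0 7 ℕ.≤-refl z≤n) (sum-≤ 6 l≤ m≤)
    M≤ : lower-bound l m ≤ z ^ 15
    M≤ = sum-≤ 14 (product-≤ 6 8 l≤ n₀≤) (weaken 6 14 m≤ (ℕ.m≤m+n 6 8))
    w≤ : linear-from (2 * p * s * c) l m ≤ z ^ 22
    w≤ = sum-≤ 21 (weaken 8 21 n₀≤ (ℕ.m≤m+n 8 13))
      (product-≤ 5 16 (product-≤ 4 1 (product-≤ 3 1 2p≤ s≤) c≤) (sum-≤ 15 (weaken 0 15 ℕ.≤-refl z≤n) M≤))

P-pos : ∀ L s → 1 ≤ P L s
P-pos zero    s = s≤s z≤n
P-pos (suc L) s = ℕ.*-mono-≤ (P-pos L s) (ℕ.≤-trans (s≤s z≤n) (ℕ.m≤n+m (suc L) s))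

γ-lower : ∀ L s z k → 1 ≤ z → z ≤ P (suc L) s → k ≤ (P (suc L) s * P (suc L) s ∸ 1) * suc L + 2 → z ^ k ≤ γ (suc L) s
γ-lower L s z k 1≤z z≤P k≤ = ℕ.≤-trans (ℕ.^-monoˡ-≤ k z≤P)
  (ℕ.≤-trans (ℕ.^-monoʳ-≤ (P (suc L) s) {{ℕ.>-nonZero (P-pos (suc L) s)}} k≤)
  (ℕ.≤-trans (ℕ.m≤m+n _ _) (ℕ.m≤n*m _ (S (suc L) s) {{ℕ.>-nonZero S-pos}})))
  where
  S-pos : 1 ≤ S (suc L) s
  S-pos = ℕ.≤-trans (s≤s z≤n) (ℕ.≤-trans (ℕ.m≤n+m (suc L) s) (ℕ.m≤n+m _ (S L s)))

-- The last two factors of the product `P` are `4s + 1 ≥ 5` and `4s + 2`, which is at least `s` and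
-- at least 6. Hence `P` is at least `5 * s` and at least 30, and the exponent in `γ` is at least
-- `30 * 30 - 1 + 2 = 901`, well above 46.
Γ-lower : ∀ s → 1 ≤ s → (5 * s) ^ 46 ≤ Γ s
Γ-lower s 1≤s = subst (λ L → (5 * s) ^ 46 ≤ γ L s) (ℕ.+-comm 2 (3 * s))
  (γ-lower (suc (3 * s)) s (5 * s) 46 (ℕ.*-mono-≤ (s≤s {n = 4} z≤n) 1≤s) (ℕ.≤-trans (ℕ.*-monoʳ-≤ 5 s≤P₂) P≥) e≥)
  where
  L = suc (3 * s)
  s≤P₂ : s ≤ s + suc L
  s≤P₂ = ℕ.m≤m+n s (suc L)
  3≤3s : 3 ≤ 3 * s
  3≤3s = ℕ.*-monoʳ-≤ 3 1≤s
  5≤P₁ : 5 ≤ P L s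
  5≤P₁ = ℕ.*-mono-≤ (P-pos (3 * s) s) (ℕ.+-mono-≤ 1≤s (s≤s 3≤3s))
  P≥ : 5 * (s + suc L) ≤ P (suc L) s
  P≥ = ℕ.*-monoˡ-≤ (s + suc L) 5≤P₁
  30≤P : 30 ≤ P (suc L) s
  30≤P = ℕ.*-mono-≤ 5≤P₁ (ℕ.+-mono-≤ 1≤s (s≤s (s≤s 3≤3s)))
  e≥ : 46 ≤ (P (suc L) s * P (suc L) s ∸ 1) * suc L + 2
  e≥ = ℕ.≤-trans (ℕ.m≤m+n 46 855) (ℕ.+-mono-≤ {899} {_} {2} {2} (ℕ.≤-trans (ℕ.∸-monoˡ-≤ 1 (ℕ.*-mono-≤ 30≤P 30≤P))
    (ℕ.m≤m*n (P (suc L) s * P (suc L) s ∸ 1) (suc L))) ℕ.≤-refl)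

-- Case analysis on `L` and conclusion.

-- With s = 1 and L = 3 only the parts 2 and 4 remain, which are not consecutive; one descent step to c = 2 replaces 2 by 1 and 3.
growth-1-3 : ∀ n → 51 ≤ n → + (4 + n) ≤ℤ (parts (without (above 1) 3) 4 ⊛ kernel 1 3) (4 + n)
growth-1-3 n 51≤n = subst (+ (4 + n) ≤ℤ_) (sym (trans (eq (4 + n))
    (cong (λ y → (geom 4 ⊛ (geom 1 ⊖ geom 2)) (4 + n) - geom 4 (4 + n) ℤ.+ y) (qpow-⊛-+ 4 Y n))))
  (ℤ.0≤i-j⇒j≤i (subst (+ 0 ≤ℤ_)
    (solve 4 (λ x g y n → x :+ (con (+ 1) :- g) :+ (y :- n :- con (+ 5)) := x :- g :+ y :- (con (+ 4) :+ n)) refl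
      ((geom 4 ⊛ (geom 1 ⊖ geom 2)) (4 + n)) (geom 4 (4 + n)) (Y n) (+ n))
    (+-nonneg (+-nonneg
      (⊛-nonneg (geom-nonneg 4) (λ i → ℤ.i≤j⇒0≤j-i (subst (geom 2 i ≤ℤ_) (sym (geom-1 i)) (if-≤1 ⌊ 2 ∣? i ⌋))) (4 + n))
      (ℤ.i≤j⇒0≤j-i (if-≤1 ⌊ 4 ∣? (4 + n) ⌋)))
      -- Here `24 = 2 * (3 * 4) * 1` is the denominator of `geom-pair-lower`. The goal `Y n ≥ n + 5`
      -- reduces to `n^2 - 48 n - 121 ≥ 0`, and this polynomial is `(n - 51)(n + 3) + 32`.
      (*-cancel-nonneg 24 (s≤s z≤n) (subst (+ 0 ≤ℤ_)
        (solve 2 (λ y n → (con (+ 24) :* y :- n :* n :+ con (+ 24) :* n :+ con (+ 1)) :+ (n :* (n :- con (+ 51)) :+ con (+ 3) :* (n :- con (+ 51)) :+ con (+ 32))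
             := con (+ 24) :* (y :- n :- con (+ 5))) refl (Y n) (+ n))
        (+-nonneg (geom-pair-lower {3} {1} (s≤s z≤n) (s≤s z≤n) n) (+-nonneg (+-nonneg
          (*-nonneg (pos-nonneg n) (ℤ.i≤j⇒0≤j-i (+≤+ 51≤n)))
          (*-nonneg (pos-nonneg 3) (ℤ.i≤j⇒0≤j-i (+≤+ 51≤n)))) (pos-nonneg 32))))))))
  where
  open ℤSolver.+-*-Solver
  Y = geom 1 ⊛ pair 3
  p = without (above 1) 3
  eq : parts p 4 ⊛ kernel 1 3 ≋ geom 4 ⊛ (geom 1 ⊖ geom 2) ⊖ geom 4 ⊕ qpow 4 ⊛ Y
  eq = begin
    parts p 4 ⊛ kernel 1 3
      ≈⟨ ⊛-congʳ (kernel 1 3) (parts-extract {p} 4 (s≤s z≤n) (s≤s (s≤s z≤n)) refl) ⟩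
    one ⊛ geom 4 ⊛ geom 2 ⊛ kernel 1 3
      ≈⟨ R.solve 3 (λ g h k → R.con (+ 1) R.:* g R.:* h R.:* k R.:= g R.:* (k R.:* h)) (λ _ → refl) (geom 4) (geom 2) (kernel 1 3) ⟩
    geom 4 ⊛ (kernel 1 3 ⊛ geom 2)
      ≈⟨ ⊛-congˡ (geom 4) (kernel-descent (s≤s z≤n) (s≤s z≤n)) ⟩
    geom 4 ⊛ (qpow 1 ⊛ geom 1 ⊖ geom 2 ⊕ qpow 1 ⊛ qpow 1 ⊛ qpow 2 ⊛ geom 1 ⊛ geom 3)
      ≈⟨ R.solve 6 (λ q r g₁ g₂ g₃ g₄ → g₄ R.:* (q R.:* g₁ R.:- g₂ R.:+ q R.:* q R.:* r R.:* g₁ R.:* g₃)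
           R.:= g₄ R.:* ((R.con (+ 1) R.:+ q R.:* g₁) R.:- g₂) R.:- g₄ R.:+ (q R.:* q R.:* r) R.:* (g₁ R.:* (g₃ R.:* g₄))) (λ _ → refl)
           (qpow 1) (qpow 2) (geom 1) (geom 2) (geom 3) (geom 4) ⟩
    geom 4 ⊛ (one ⊕ qpow 1 ⊛ geom 1 ⊖ geom 2) ⊖ geom 4 ⊕ (qpow 1 ⊛ qpow 1 ⊛ qpow 2) ⊛ Y
      ≈⟨ ⊕-cong (⊖-cong {g = geom 4} (⊛-congˡ (geom 4) (⊖-cong {g = geom 2} (≋-sym (geom-unfold (s≤s z≤n))) ≋-refl)) ≋-refl)
           (⊛-congʳ Y (≋-trans (⊛-congʳ (qpow 2) (qpow-+ 1 1)) (qpow-+ 2 2))) ⟩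
    geom 4 ⊛ (geom 1 ⊖ geom 2) ⊖ geom 4 ⊕ qpow 4 ⊛ Y ∎
    where open ≋-Reasoning
          module R = PS-Solver

-- For `L = s + 1` the pair is `s + 2, s + 3`, which fits below `s + L` because `L ≥ 3` gives
-- `s ≥ 2`. For `L = s + 2` it is `s + 3, s + 4`, which needs `s ≥ 2` and leaves `growth-1-3` for
-- `s = 1`. For larger `L` the descent preserves `s + 1, s + 2`.
growth : ∀ L s → 1 ≤ s → 3 ≤ L → s + 1 ≤ L → ∀ n → (5 * s) ^ 46 ≤ n →
  + n ≤ℤ (parts (without (above s) L) (s + L) ⊛ kernel s L) n
growth L s 1≤s 3≤L s<L n large = cases (ℕ.m≤n⇒m<n∨m≡n s+1≤L)
  where
  -- Large enough for every part and index used: `s + 4` and `2 * s + 2` are both at most `5 * s`.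
  z = 5 * s
  p = without (above s) L
  t = s + L
  s+1≤L : suc s ≤ L
  s+1≤L = subst (_≤ L) (ℕ.+-comm s 1) s<L
  5≤z : 5 ≤ z
  5≤z = ℕ.*-monoʳ-≤ 5 1≤s
  open PowerBounds z (ℕ.≤-trans (ℕ.n≤1+n 4) 5≤z)
  s≤z : s ≤ z
  s≤z = ℕ.m≤n*m s 5
  s+k≤z : ∀ k → k ≤ 4 → k + s ≤ z
  s+k≤z k k≤4 = subst (k + s ≤_) (ℕ.+-comm (4 * s) s) (ℕ.+-monoˡ-≤ s (ℕ.≤-trans k≤4 (ℕ.*-monoʳ-≤ 4 1≤s)))
  below : ∀ a c → suc a ≤ z → c ≤ z → threshold (a * suc a) s c < n
  below a c a≤z c≤z = ℕ.<-≤-trans (threshold-< (product-≤ 1 1 (base-≤ (ℕ.<⇒≤ a≤z)) (base-≤ a≤z)) s≤z c≤z) large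
  p-true : ∀ {a} → s < a → a ≢ L → p a ≡ true
  p-true s<a a≢L = trans (without-≢ (above s) a≢L) (above-true s<a)
  cases : suc s < L ⊎ suc s ≡ L → + n ≤ℤ (parts p t ⊛ kernel s L) n
  cases (inj₂ refl) = parts-kernel {p} {2 + s} (s + L) (s≤s z≤n) 3+s≤
      (p-true (s≤s (ℕ.n≤1+n s)) (ℕ.>⇒≢ ℕ.≤-refl)) (p-true (s≤s (ℕ.m≤n+m s 2)) (ℕ.>⇒≢ (s≤s (ℕ.n≤1+n (suc s)))))
      1≤s s+1≤L n (below (2 + s) (suc s) (s+k≤z 3 (ℕ.n≤1+n 3)) (s+k≤z 1 (s≤s z≤n)))
    where
    3+s≤ : 3 + s ≤ s + suc s
    3+s≤ = subst (3 + s ≤_) (ℕ.+-comm (suc s) s) (ℕ.+-monoˡ-≤ s 3≤L)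
  cases (inj₁ s+2≤L) with ℕ.m≤n⇒m<n∨m≡n s+2≤L
  ... | inj₂ refl = two (ℕ.m≤n⇒m<n∨m≡n 1≤s)
    where
    two : 1 < s ⊎ 1 ≡ s → + n ≤ℤ (parts p t ⊛ kernel s (2 + s)) n
    two (inj₂ refl) = subst (λ m → + m ≤ℤ (parts p t ⊛ kernel 1 3) m) (ℕ.m+[n∸m]≡n 4≤n)
      (growth-1-3 (n ∸ 4) (ℕ.m+n≤o⇒m≤o∸n 51 55≤n))
      where
      55≤n : 55 ≤ n
      55≤n = ℕ.≤-trans (ℕ.≤-trans (ℕ.m≤m+n 55 70) (ℕ.^-monoʳ-≤ 5 (ℕ.m≤m+n 3 43))) large
      4≤n : 4 ≤ n
      4≤n = ℕ.≤-trans (ℕ.m≤m+n 4 51) 55≤n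
    two (inj₁ 2≤s) = parts-kernel {p} {3 + s} (s + L) (s≤s z≤n) (subst (4 + s ≤_) (ℕ.+-comm (2 + s) s) (ℕ.+-monoˡ-≤ s (s≤s (s≤s 2≤s))))
      (p-true (s≤s (ℕ.m≤n+m s 2)) (ℕ.>⇒≢ ℕ.≤-refl)) (p-true (s≤s (ℕ.m≤n+m s 3)) (ℕ.>⇒≢ (ℕ.n≤1+n (3 + s))))
      1≤s s+1≤L n (below (3 + s) (2 + s) (s+k≤z 4 ℕ.≤-refl) (s+k≤z 2 (s≤s (s≤s z≤n))))
  ... | inj₁ s+3≤L = finish (descend t L p L ℕ.≤-refl 1≤s (subst (_≤ L) (ℕ.+-comm 3 s) s+3≤L) (ℕ.m≤n+m L s)
                       (λ j s<j j<L → p-true s<j (ℕ.<⇒≢ j<L)))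
    where
    finish : Descended s t p L → + n ≤ℤ (parts p t ⊛ kernel s L) n
    finish (c , p′ , s+3≤c , c≤ , t₁ , t₂ , le) = ℤ.≤-trans
      (parts-kernel {p′} {suc s} t (s≤s z≤n) (ℕ.≤-trans s+2≤L (ℕ.m≤n+m L s)) t₁ t₂ 1≤s
        (ℕ.<-≤-trans (ℕ.m<m+n s (s≤s z≤n)) s+3≤c) n
        (below (suc s) c (s+k≤z 2 (s≤s (s≤s z≤n))) (ℕ.≤-trans c≤ 2s+2≤z)))
      (le n)
      where
      2s+2≤z : 2 * s + 2 ≤ z
      2s+2≤z = ℕ.≤-trans (ℕ.+-monoʳ-≤ (2 * s) (ℕ.≤-trans (ℕ.n≤1+n 2) (ℕ.*-monoʳ-≤ 3 1≤s)))
        (ℕ.≤-reflexive (sym (ℕ.*-distribʳ-+ s 2 3)))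

theorem8 : (L s : ℕ) → 1 ≤ s → 3 ≤ L → s + 1 ≤ L →
    (N : ℕ) → Γ s ≤ N →
    ((+ N - + (10 * s)) /ℕ ((2 + s) * (3 + s))) ≤ℤ H L s L N
theorem8 L s 1≤s 3≤L s<L N Γ≤N = ℤ.≤-trans
  (/ℕ-upper (+ N - + (10 * s)) ((2 + s) * (3 + s)) N (ℤ.i-j≤i (+ N) (+ (10 * s))))
  (subst (+ N ≤ℤ_) (sym H≡) (growth L s 1≤s 3≤L s<L N large))
  where
  large : (5 * s) ^ 46 ≤ N
  large = ℕ.≤-trans (Γ-lower s 1≤s) Γ≤N
  L>0 : 0 < L
  L>0 = ℕ.≤-trans (s≤s z≤n) 3≤L
  p = without (above s) L
  split : invPoch (suc s) L ≋ parts p (s + L) ⊛ geom L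
  split = ≋-trans (invPoch-parts s L) (parts-extract (s + L) L>0 (ℕ.m≤n+m L s) (above-true (subst (_≤ L) (ℕ.+-comm s 1) s<L)))
  0<N : 0 < N
  0<N = ℕ.≤-trans (ℕ.m^n>0 (5 * s) {{ℕ.>-nonZero (ℕ.*-mono-≤ (s≤s {n = 4} z≤n) 1≤s)}} 46) large
  -- The extra summand `one` from `H-kernel` only affects degree 0, and `N` is positive.
  H≡ : H L s L N ≡ (parts p (s + L) ⊛ kernel s L) N
  H≡ = trans (H-kernel {f = parts p (s + L)} L>0 split N) (trans (+-congˡ ((parts p (s + L) ⊛ kernel s L) N) (one-pos 0<N)) (ℤ.+-identityʳ _))
    where
    one-pos : ∀ {n} → 0 < n → one n ≡ + 0
    one-pos (s≤s _) = refl
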